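{- Let $H_m=H_{(m)}$ for $m\ge1$ and $\tilde H_n=H_{(\dot n)}$ for $n\ge0$. Then $${\rm sNSym}\cong\mathbb Q\langle H_1,H_2,\dots;\tilde H_0,\tilde H_1,\dots\rangle,$$ the free associative algebra with noncommuting generators $\{H_1,H_2,\dots;\tilde H_0,\tilde H_1,\dots\}$, with coproduct defined by $$\Delta H_n=\sum_{i+j=n}H_i\otimes H_j\qquad\text{and}\qquad\Delta\tilde H_i=\sum_{k+\ell=i}\left(\tilde H_k\otimes H_\ell+H_\ell\otimes\tilde H_k\right),$$ where the sums are over pairs of non-negative integers and $H_0=1$.
   Context: Variables $x_1,x_2,\dots$ commute; $\theta_1,\theta_2,\dots$ anticommute ($\theta_i\theta_j=-\theta_j\theta_i$, $\theta_i^2=0$). A dotted composition $\alpha=(\alpha_1,\dots,\alpha_l)$ is a finite (possibly empty) sequence whose entries belong to $\{1,2,3,\dots\}$ (non-dotted) or $\{\dot0,\dot1,\dot2,\dots\}$ (dotted); its fermionic degree is its number of dotted parts. Put $\eta_i=1$ if $\alpha_i$ is dotted and $\eta_i=0$ otherwise. ${\rm sQSym}$ is the $\mathbb Q$-algebra of quasisymmetric functions in superspace, with basis $M_\alpha=\sum_{i_1<\cdots<i_l}\theta_{i_1}^{\eta_1}\cdots\theta_{i_l}^{\eta_l}x_{i_1}^{\alpha_1}\cdots x_{i_l}^{\alpha_l}$ over all dotted compositions $\alpha$ (dots ignored in exponents of $x$; $M_\emptyset=1$), multiplied as power series of bounded degree. It is a graded connected Hopf algebra (graded by the sum of the degrees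 in $x$ and in $\theta$, with finite-dimensional homogeneous components), with coproduct $\Delta(M_\alpha)=\sum_{k=0}^lM_{(\alpha_1,\dots,\alpha_k)}\otimes M_{(\alpha_{k+1},\dots,\alpha_l)}$, the tensor square carrying the product $(f_1\otimes g_1)(f_2\otimes g_2)=(-1)^{ab}f_1f_2\otimes g_1g_2$ for $g_1,f_2$ of fermionic degrees $a,b$. The ring ${\rm sNSym}$ of noncommutative symmetric functions in superspace is the (graded) Hopf dual of ${\rm sQSym}$, with dual pairing $\langle\cdot,\cdot\rangle:{\rm sNSym}\otimes{\rm sQSym}\to\mathbb Q$ and $\mathbb Q$-basis $\{H_\alpha\}$, indexed by dotted compositions, dual to the monomials: $\langle H_\alpha,M_\beta\rangle=\delta_{\alpha\beta}$. $H_\alpha$ has the fermionic degree of $\alpha$. Being dually paired means that, for all $F,G\in{\rm sNSym}$ and $a,b\in{\rm sQSym}$, $\langle FG,a\rangle=\langle F\otimes G,\Delta(a)\rangle$, $\langle F,ab\rangle=\langle\Delta(F),a\otimes b\rangle$, $\langle1,a\rangle=\epsilon(a)$, $\langle F,1\rangle=\epsilon(F)$ and $\langle S(F),a\rangle=\langle F,S(a)\rangle$ ($\epsilon$ the counits, $S$ the antipodes). Here the pairing of tensors is $\langle\cdot,\cdot\rangle\otimes\langle\cdot,\cdot\rangle$ preceded by the signed twist $G\otimes a\mapsto(-1)^{\deg(G)\deg(a)}a\otimes G$ of the two middle factors, that is, $\langle F\otimes G,a\otimes b\rangle=(-1)^{\deg(G)\deg(a)}\langle F,a\rangle\langle G,b\rangle$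 for homogeneous elements, where $\deg$ is the fermionic degree. The tensor square of ${\rm sNSym}$ carries the same signed product as that of ${\rm sQSym}$; the coproduct of ${\rm sNSym}$ is an algebra morphism for it, so it is determined by its values on generators. -}

module Defs where

open import Algebra.Bundles.Raw using (RawRing)
open import Data.Bool using (Bool; true; false; if_then_else_)
import Data.Bool.Properties as Bool
open import Data.List using (List; []; _∷_; _++_; map; concat; concatMap; foldr; length; take; drop; upTo; cartesianProduct; replicate)
import Data.List.Properties as List
open import Data.Nat using (ℕ; zero; suc; _∸_)
import Data.Nat as ℕ
import Data.Nat.Properties as ℕ
open import Data.Product using (_×_; _,_)
import Data.Product.Properties as Product
open import Data.Rational using (ℚ; 0ℚ; 1ℚ; _+_; _*_; -_)
open import Level using (0ℓ)
open import Relation.Binary using (DecidableEquality)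
open import Relation.Binary.PropositionalEquality using (_≡_; refl)
open import Relation.Nullary using (yes; no; does)

private
  variable
    A B C D : Set

-- The free ℚ-module on a set B: a list of (coefficient , basis element)
-- pairs stands for the sum of its terms.  Terms may repeat or cancel, so
-- elements are compared with the coefficientwise equality `Equality._≈_`.
Span : Set → Set
Span B = List (ℚ × B)

infixr 8 _•_
infixr 6 _⊞_
infixr 7 _⊗_

_⊞_ : Span B → Span B → Span B
_⊞_ = _++_

0# : Span B
0# = []

_•_ : ℚ → Span B → Span B
c • f = map (λ (d , b) → (c * d , b)) f

⊟_ : Span B → Span B
⊟ f = (- 1ℚ) • f

basis : B → Span B
basis b = (1ℚ , b) ∷ []

∑ : List A → (A → Span B) → Span B
∑ xs f = concatMap f xs

∑ℚ : List A → (A → ℚ) → ℚ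
∑ℚ xs f = foldr (λ x s → f x + s) 0ℚ xs

functional : (B → ℚ) → Span B → ℚ
functional h f = ∑ℚ f (λ (c , b) → c * h b)

linear : (B → Span C) → Span B → Span C
linear h f = ∑ f (λ (c , b) → c • h b)

bilinear : (A → B → Span C) → Span A → Span B → Span C
bilinear h f g = linear (λ a → linear (h a) g) f

-- ℚ[B] ⊗ ℚ[C] is ℚ[B × C].
_⊗_ : Span B → Span C → Span (B × C)
_⊗_ = bilinear (λ b c → basis (b , c))

δ : DecidableEquality B → B → B → ℚ
δ _≟_ b b′ = if does (b ≟ b′) then 1ℚ else 0ℚ

module Equality (_≟_ : DecidableEquality B) where
  infix 4 _≈_

  coeff : Span B → B → ℚ
  coeff f b = functional (λ b′ → δ _≟_ b′ b) f

  _≈_ : Span B → Span B → Set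
  f ≈ g = ∀ b → coeff f b ≡ coeff g b

sign : ℕ → ℚ
sign zero    = 1ℚ
sign (suc n) = - sign n

antidiagonal : ℕ → List (ℕ × ℕ)
antidiagonal n = map (λ i → (i , n ∸ i)) (upTo (suc n))

-- The algebra with basis B and structure map μ, and its tensor square with
-- (f₁ ⊗ g₁)(f₂ ⊗ g₂) = (-1)^(deg g₁ · deg f₂) f₁ f₂ ⊗ g₁ g₂.
module Superalgebra (_≟_ : DecidableEquality B) (ferm : B → ℕ)
                    (μ : B → B → Span B) (unit : B) where
  infixl 7 _·_ _·₂_

  _·_ : Span B → Span B → Span B
  _·_ = bilinear μ

  𝟙 : Span B
  𝟙 = basis unit

  _·₂_ : Span (B × B) → Span (B × B) → Span (B × B)
  _·₂_ = bilinear λ (f₁ , g₁) (f₂ , g₂) →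
           sign (ferm g₁ ℕ.* ferm f₂) • (μ f₁ f₂ ⊗ μ g₁ g₂)

  𝟙₂ : Span (B × B)
  𝟙₂ = 𝟙 ⊗ 𝟙

  open Equality _≟_ public using (_≈_)
  open Equality (Product.≡-dec _≟_ _≟_) public using () renaming (_≈_ to _≈₂_)

  rawRing : RawRing 0ℓ 0ℓ
  rawRing = record
    { Carrier = Span B
    ; _≈_ = _≈_
    ; _+_ = _⊞_
    ; _*_ = _·_
    ; -_  = ⊟_
    ; 0#  = 0#
    ; 1#  = 𝟙
    }

-- plain[1+ m ] is the non-dotted part m + 1; dotted[ m ] is the dotted part m.
data Part : Set where
  plain[1+_] : ℕ → Part
  dotted[_]  : ℕ → Part

_≟ᴾ_ : DecidableEquality Part
plain[1+ m ] ≟ᴾ plain[1+ n ] with m ℕ.≟ n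
... | yes refl = yes refl
... | no  m≢n  = no λ { refl → m≢n refl }
plain[1+ m ] ≟ᴾ dotted[ n ]  = no λ ()
dotted[ m ]  ≟ᴾ plain[1+ n ] = no λ ()
dotted[ m ]  ≟ᴾ dotted[ n ]  with m ℕ.≟ n
... | yes refl = yes refl
... | no  m≢n  = no λ { refl → m≢n refl }

DComp : Set
DComp = List Part

_≟ᴰ_ : DecidableEquality DComp
_≟ᴰ_ = List.≡-dec _≟ᴾ_

ferm : DComp → ℕ
ferm []                 = 0
ferm (plain[1+ _ ] ∷ α) = ferm α
ferm (dotted[ _ ]  ∷ α) = suc (ferm α)

-- Total degree, in x and θ together.
deg : DComp → ℕ
deg []                 = 0
deg (plain[1+ m ] ∷ α) = suc m ℕ.+ deg α
deg (dotted[ m ]  ∷ α) = suc m ℕ.+ deg α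

increment : Part → Part
increment plain[1+ m ] = plain[1+ suc m ]
increment dotted[ m ]  = dotted[ suc m ]

-- The dotted compositions of total degree n, each exactly once: the first
-- part of a dotted composition of degree n + 1 either has degree 1 (it is
-- 1 or dotted 0), or is the increment of the first part of a dotted
-- composition of degree n.
ofDegree : ℕ → List DComp
ofDegree zero    = [] ∷ []
ofDegree (suc n) = concatMap grow (ofDegree n)
  where
  grow : DComp → List DComp
  grow []      = (plain[1+ 0 ] ∷ []) ∷ (dotted[ 0 ] ∷ []) ∷ []
  grow (p ∷ α) = (plain[1+ 0 ] ∷ p ∷ α) ∷ (dotted[ 0 ] ∷ p ∷ α)
               ∷ (increment p ∷ α) ∷ []

-- The letter (η , a) in position i stands for θᵢ^η xᵢ^a.  A list of n letters
-- is the monomial θ₁^η₁ ⋯ θₙ^ηₙ x₁^a₁ ⋯ xₙ^aₙ, with the θ's in increasing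
-- order; appending the trivial letter does not change the monomial.
Letter : Set
Letter = Bool × ℕ

trivial : Letter
trivial = (false , 0)

Mono : Set
Mono = List Letter

_≟ᴹ_ : DecidableEquality Mono
_≟ᴹ_ = List.≡-dec (Product.≡-dec Bool._≟_ ℕ._≟_)

Series : Set
Series = Mono → ℚ

#θ : Mono → ℕ
#θ []                = 0
#θ ((false , _) ∷ u) = #θ u
#θ ((true  , _) ∷ u) = suc (#θ u)

-- The number of pairs p > q with θ_p in u and θ_q in v: the number of
-- transpositions that sort the θ's of the juxtaposition u v.
inversions : Mono → Mono → ℕ
inversions (a ∷ u) ((true  , _) ∷ v) = #θ u ℕ.+ inversions u v
inversions (a ∷ u) ((false , _) ∷ v) = inversions u v
inversions _       _                 = 0

-- All ways to write a monomial as a product of two, up to sign; θ² = 0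
-- forbids that both factors contain the same θ.
letterFactorisations : Letter → List (Letter × Letter)
letterFactorisations (η , a) =
  concatMap (λ (η₁ , η₂) → map (λ (i , j) → ((η₁ , i) , (η₂ , j))) (antidiagonal a))
            (θ-part η)
  where
  θ-part : Bool → List (Bool × Bool)
  θ-part false = (false , false) ∷ []
  θ-part true  = (true , false) ∷ (false , true) ∷ []

factorisations : Mono → List (Mono × Mono)
factorisations []      = ([] , []) ∷ []
factorisations (a ∷ w) =
  concatMap (λ (b , c) → map (λ (u , v) → (b ∷ u , c ∷ v)) (factorisations w))
            (letterFactorisations a)

infixl 7 _⋆_

_⋆_ : Series → Series → Series
(f ⋆ g) w = ∑ℚ (factorisations w) (λ (u , v) → sign (inversions u v) * (f u * g v))

letter : Part → Letter
letter plain[1+ m ] = (false , suc m)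
letter dotted[ m ]  = (true , m)

-- The monomials θ_{i₁}^η₁ ⋯ θ_{iₗ}^ηₗ x_{i₁}^α₁ ⋯ x_{iₗ}^αₗ, one for each
-- choice of 1 ≤ i₁ < ⋯ < iₗ ≤ n, written in the first n variables.
placements : DComp → ℕ → List Mono
placements []      n       = replicate n trivial ∷ []
placements (p ∷ α) zero    = []
placements (p ∷ α) (suc n) = map (letter p ∷_) (placements α n)
                          ++ map (trivial ∷_) (placements (p ∷ α) n)

monomialSeries : DComp → Series
monomialSeries α w = ∑ℚ (placements α (length w)) (λ u → δ _≟ᴹ_ u w)

-- The coefficient of M_γ in a quasisymmetric function is its coefficient at
-- θ₁^η₁ ⋯ θₗ^ηₗ x₁^γ₁ ⋯ xₗ^γₗ, a monomial that occurs in no other M_β.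
leading : DComp → Mono
leading = map letter

-- Elements are written in the basis M_α.
sQSym sQSym⊗sQSym : Set
sQSym       = Span DComp
sQSym⊗sQSym = Span (DComp × DComp)

M : DComp → sQSym
M = basis

-- M_α M_β is homogeneous of degree |α| + |β|, so it is the sum over the γ of
-- that degree of its M_γ-components.
M-product : DComp → DComp → sQSym
M-product α β = ∑ (ofDegree (deg α ℕ.+ deg β)) λ γ →
                  (monomialSeries α ⋆ monomialSeries β) (leading γ) • M γ

M-coproduct : DComp → sQSym⊗sQSym
M-coproduct α = ∑ (upTo (suc (length α))) λ k → M (take k α) ⊗ M (drop k α)

-- The graded dual, written in the basis H_α dual to M_α.
sNSym sNSym⊗sNSym : Set
sNSym       = Span DComp
sNSym⊗sNSym = Span (DComp × DComp)

Hᴰ : DComp → sNSym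
Hᴰ = basis

⟨_,_⟩ : sNSym → sQSym → ℚ
⟨ F , a ⟩ = functional (λ α → functional (λ β → δ _≟ᴰ_ α β) a) F

-- The middle factors H_β and M_γ are exchanged, with their sign.
⟨_,_⟩₂ : sNSym⊗sNSym → sQSym⊗sQSym → ℚ
⟨ F , a ⟩₂ = functional (λ (α , β) → functional (λ (γ , ε) →
  sign (ferm β ℕ.* ferm γ) * (⟨ Hᴰ α , M γ ⟩ * ⟨ Hᴰ β , M ε ⟩)) a) F

-- The product with ⟨ F G , a ⟩ = ⟨ F ⊗ G , Δ a ⟩₂: the coefficient of H_γ in
-- H_α H_β is ⟨ H_α H_β , M_γ ⟩, which vanishes unless |γ| = |α| + |β|.
H-product : DComp → DComp → sNSym
H-product α β = ∑ (ofDegree (deg α ℕ.+ deg β)) λ γ →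
                  ⟨ Hᴰ α ⊗ Hᴰ β , M-coproduct γ ⟩₂ • Hᴰ γ

-- The coproduct with ⟨ F , a b ⟩ = ⟨ Δ F , a ⊗ b ⟩₂.  Only H_α ⊗ H_β pairs
-- nontrivially with M_α ⊗ M_β, and the value is a sign s, so the coefficient
-- of H_α ⊗ H_β in Δ H_γ is s ⟨ H_γ , M_α M_β ⟩, which vanishes unless
-- |α| + |β| = |γ|.
H-coproduct : DComp → sNSym⊗sNSym
H-coproduct γ =
  ∑ (antidiagonal (deg γ)) λ (i , j) →
  ∑ (cartesianProduct (ofDegree i) (ofDegree j)) λ (α , β) →
    (⟨ Hᴰ α ⊗ Hᴰ β , M α ⊗ M β ⟩₂ * ⟨ Hᴰ γ , M-product α β ⟩) • (Hᴰ α ⊗ Hᴰ β)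

-- The unit is H_∅, because ⟨ 1 , M_α ⟩ = ε(M_α).
module SNSym = Superalgebra _≟ᴰ_ ferm H-product []

ΔS : sNSym → sNSym⊗sNSym
ΔS = linear H-coproduct

H : ℕ → sNSym
H zero    = SNSym.𝟙
H (suc m) = Hᴰ (plain[1+ m ] ∷ [])

H̃ : ℕ → sNSym
H̃ n = Hᴰ (dotted[ n ] ∷ [])

-- Words in the generators H₁ , H₂ , … ; H̃₀ , H̃₁ , … are the basis of the free
-- associative algebra; `H[1+ m ] is the generator H_{m+1}.
data Generator : Set where
  `H[1+_] : ℕ → Generator
  `H̃[_]   : ℕ → Generator

_≟ᴳ_ : DecidableEquality Generator
`H[1+ m ] ≟ᴳ `H[1+ n ] with m ℕ.≟ n
... | yes refl = yes refl
... | no  m≢n  = no λ { refl → m≢n refl }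
`H[1+ m ] ≟ᴳ `H̃[ n ]   = no λ ()
`H̃[ m ]   ≟ᴳ `H[1+ n ] = no λ ()
`H̃[ m ]   ≟ᴳ `H̃[ n ]   with m ℕ.≟ n
... | yes refl = yes refl
... | no  m≢n  = no λ { refl → m≢n refl }

Word : Set
Word = List Generator

fermWord : Word → ℕ
fermWord []               = 0
fermWord (`H[1+ _ ] ∷ w) = fermWord w
fermWord (`H̃[ _ ]   ∷ w) = suc (fermWord w)

module Free = Superalgebra (List.≡-dec _≟ᴳ_) fermWord (λ u v → basis (u ++ v)) []

FreeAlgebra FreeAlgebra⊗FreeAlgebra : Set
FreeAlgebra             = Span Word
FreeAlgebra⊗FreeAlgebra = Span (Word × Word)

`H : ℕ → FreeAlgebra
`H zero    = Free.𝟙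
`H (suc m) = basis (`H[1+ m ] ∷ [])

`H̃ : ℕ → FreeAlgebra
`H̃ n = basis (`H̃[ n ] ∷ [])

ΔGenerator : Generator → FreeAlgebra⊗FreeAlgebra
ΔGenerator `H[1+ m ] = ∑ (antidiagonal (suc m)) λ (i , j) → `H i ⊗ `H j
ΔGenerator `H̃[ n ]   = ∑ (antidiagonal n) λ (k , l) → `H̃ k ⊗ `H l ⊞ `H l ⊗ `H̃ k

-- The algebra morphism into the signed tensor square that extends ΔGenerator.
ΔFree : FreeAlgebra → FreeAlgebra⊗FreeAlgebra
ΔFree = linear (foldr (λ g t → ΔGenerator g Free.·₂ t) Free.𝟙₂)

-- evaluate is the algebra morphism from the free algebra to sNSym that sends
-- each generator to the element of the same name.
generatorImage : Generator → sNSym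
generatorImage `H[1+ m ] = H (suc m)
generatorImage `H̃[ n ]   = H̃ n

evaluateWord : Word → sNSym
evaluateWord = foldr (λ g F → generatorImage g SNSym.· F) SNSym.𝟙

evaluate : FreeAlgebra → sNSym
evaluate = linear evaluateWord

evaluate⊗evaluate : FreeAlgebra⊗FreeAlgebra → sNSym⊗sNSym
evaluate⊗evaluate = linear (λ (u , v) → evaluateWord u ⊗ evaluateWord v)

{-# OPTIONS --safe #-}

-- Pairing with the basis M_γ shows that H_α H_β = ± H_{αβ} (concatenation) with
-- sign (-1)^(ferm α · ferm β), so a word in the generators goes to ± the H indexed
-- by the same sequence, and evaluate is bijective.
--
-- Dually to the product of monomial series, Δ H_γ is a signed sum over the
-- factorisations of the leading monomial of M_γ.  A factorisation is chosen
-- letter by letter, so Δ H_{pγ} is Δ H_p times Δ H_γ up to signs; each letter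
-- contributes the sum that defines ΔGenerator, and the signs agree for each
-- factorisation separately.
--
-- Equality of elements is proved by comparing the values of all linear
-- functionals, which turns every identity into one between finite sums.
module Submission where

open import Defs
open import Algebra.Morphism.Structures using (IsRingIsomorphism)
import Algebra.Properties.CommutativeSemigroup as CommutativeSemigroup
import Data.Bool as Bool
open import Data.Bool using (true; false)
open import Data.List
  using (List; []; _∷_; _++_; map; concatMap; upTo; applyUpTo; cartesianProduct; foldr; length; take; drop; replicate)
import Data.List.Properties as List
open import Data.List.Relation.Unary.All using (All; []; _∷_)
import Data.List.Relation.Unary.All as All
import Data.List.Relation.Unary.All.Properties as All
open import Data.Nat using (ℕ; zero; suc; _∸_)
import Data.Nat as ℕ
import Data.Nat.Properties as ℕ
open import Data.Nat.Tactic.RingSolver using (solve-∀)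
open import Data.Product using (_×_; _,_; proj₁; proj₂)
import Data.Product.Properties as Product
open import Data.Rational using (ℚ; 0ℚ; 1ℚ; _+_; _*_; -_)
import Data.Rational.Properties as ℚ
open import Data.Rational.Solver using (module +-*-Solver)
open import Function using (_∘_; id)
open import Function.Bundles using (_⇔_; mk⇔; Equivalence)
open import Relation.Binary using (DecidableEquality)
open import Relation.Binary.PropositionalEquality
  using (_≡_; _≢_; _≗_; refl; sym; trans; cong; cong₂; module ≡-Reasoning)
open import Relation.Nullary using (yes; no; contradiction)

-- Products and coproducts in `sNSym` are defined as sums over the enumeration `ofDegree`, so
-- nothing collapses until each dotted composition is known to be listed exactly once;
-- `multiplicity-ofDegree` supplies this. Identities are stated for an arbitrary functional h
-- because of the recursion on words: removing the first letter replaces h by a functional that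
-- prepends a part and carries a sign, a form that a coordinate functional need not keep. Three
-- signs meet in the coproduct. A word with m dotted generators acquires (-1)^(m(m-1)/2) under
-- evaluation; a factorisation carries the inversions of its θ's together with the twist of the dual
-- pairing; and the tensor square has its own exchange rule. Only the total exponent modulo 2 is
-- compared. The factors of a leading monomial have gaps, at the positions whose letter went wholly
-- to the other factor. The recursion therefore runs over monomials with trivial letters and passes
-- to dotted compositions by `strip`.

module ℕ-+ = CommutativeSemigroup ℕ.+-commutativeSemigroup
open ≡-Reasoning
open +-*-Solver using (solve; _:=_; _:*_; _:+_; con)

private
  variable
    A B C : Set

-- Finite sums

-- Some termwise identities below hold only for genuine factorisations of a monomial, not for every
-- pair of monomials, hence the hypothesis over the entries of the list.
∑ℚ-cong-All : {f g : A → ℚ} {xs : List A} →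
              All (λ x → f x ≡ g x) xs → ∑ℚ xs f ≡ ∑ℚ xs g
∑ℚ-cong-All []       = refl
∑ℚ-cong-All (e ∷ es) = cong₂ _+_ e (∑ℚ-cong-All es)

∑ℚ-cong : {f g : A → ℚ} (xs : List A) → f ≗ g → ∑ℚ xs f ≡ ∑ℚ xs g
∑ℚ-cong xs e = ∑ℚ-cong-All (All.universal e xs)

∑ℚ-zero : (xs : List A) → ∑ℚ xs (λ _ → 0ℚ) ≡ 0ℚ
∑ℚ-zero []       = refl
∑ℚ-zero (x ∷ xs) = trans (ℚ.+-identityˡ _) (∑ℚ-zero xs)

∑ℚ-++ : (f : A → ℚ) (xs ys : List A) → ∑ℚ (xs ++ ys) f ≡ ∑ℚ xs f + ∑ℚ ys f
∑ℚ-++ f []       ys = sym (ℚ.+-identityˡ _)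
∑ℚ-++ f (x ∷ xs) ys = trans (cong (f x +_) (∑ℚ-++ f xs ys)) (sym (ℚ.+-assoc (f x) _ _))

∑ℚ-map : (f : B → ℚ) (g : A → B) (xs : List A) → ∑ℚ (map g xs) f ≡ ∑ℚ xs (f ∘ g)
∑ℚ-map f g []       = refl
∑ℚ-map f g (x ∷ xs) = cong (f (g x) +_) (∑ℚ-map f g xs)

∑ℚ-concatMap : (f : B → ℚ) (g : A → List B) (xs : List A) →
               ∑ℚ (concatMap g xs) f ≡ ∑ℚ xs (λ x → ∑ℚ (g x) f)
∑ℚ-concatMap f g []       = refl
∑ℚ-concatMap f g (x ∷ xs) =
  trans (∑ℚ-++ f (g x) (concatMap g xs)) (cong (∑ℚ (g x) f +_) (∑ℚ-concatMap f g xs))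

∑ℚ-cartesianProduct : (f : A × B → ℚ) (xs : List A) (ys : List B) →
  ∑ℚ (cartesianProduct xs ys) f ≡ ∑ℚ xs (λ x → ∑ℚ ys (λ y → f (x , y)))
∑ℚ-cartesianProduct f []       ys = refl
∑ℚ-cartesianProduct f (x ∷ xs) ys =
  trans (∑ℚ-++ f (map (x ,_) ys) _)
        (cong₂ _+_ (∑ℚ-map f (x ,_) ys) (∑ℚ-cartesianProduct f xs ys))

+-interchange : ∀ a b c d → (a + b) + (c + d) ≡ (a + c) + (b + d)
+-interchange = solve 4 (λ a b c d → (a :+ b) :+ (c :+ d) := (a :+ c) :+ (b :+ d)) refl

∑ℚ-+ : (f g : A → ℚ) (xs : List A) → ∑ℚ xs (λ x → f x + g x) ≡ ∑ℚ xs f + ∑ℚ xs g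
∑ℚ-+ f g []       = refl
∑ℚ-+ f g (x ∷ xs) =
  trans (cong (f x + g x +_) (∑ℚ-+ f g xs)) (+-interchange (f x) (g x) _ _)

∑ℚ-swap : (f : A → B → ℚ) (xs : List A) (ys : List B) →
  ∑ℚ xs (λ x → ∑ℚ ys (f x)) ≡ ∑ℚ ys (λ y → ∑ℚ xs (λ x → f x y))
∑ℚ-swap f []       ys = sym (∑ℚ-zero ys)
∑ℚ-swap f (x ∷ xs) ys =
  trans (cong (∑ℚ ys (f x) +_) (∑ℚ-swap f xs ys)) (sym (∑ℚ-+ (f x) _ ys))

*-∑ℚ : (c : ℚ) (f : A → ℚ) (xs : List A) → c * ∑ℚ xs f ≡ ∑ℚ xs (λ x → c * f x)
*-∑ℚ c f []       = ℚ.*-zeroʳ c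
*-∑ℚ c f (x ∷ xs) =
  trans (ℚ.*-distribˡ-+ c (f x) _) (cong (c * f x +_) (*-∑ℚ c f xs))

∑ℚ-* : (f : A → ℚ) (c : ℚ) (xs : List A) → ∑ℚ xs f * c ≡ ∑ℚ xs (λ x → f x * c)
∑ℚ-* f c xs = begin
  ∑ℚ xs f * c              ≡⟨ ℚ.*-comm (∑ℚ xs f) c ⟩
  c * ∑ℚ xs f              ≡⟨ *-∑ℚ c f xs ⟩
  ∑ℚ xs (λ x → c * f x)    ≡⟨ ∑ℚ-cong xs (λ x → ℚ.*-comm c (f x)) ⟩
  ∑ℚ xs (λ x → f x * c)    ∎

*-swap : ∀ a b c → a * (b * c) ≡ b * (a * c)
*-swap = solve 3 (λ a b c → a :* (b :* c) := b :* (a :* c)) refl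

*-interchange : ∀ a b c d → (a * b) * (c * d) ≡ (a * c) * (b * d)
*-interchange = solve 4 (λ a b c d → (a :* b) :* (c :* d) := (a :* c) :* (b :* d)) refl

-- Linear functionals

weigh : (B → ℚ) → ℚ × B → ℚ
weigh h (c , b) = c * h b

functional-cong : {h k : B → ℚ} (f : Span B) → h ≗ k → functional h f ≡ functional k f
functional-cong f e = ∑ℚ-cong f λ (c , b) → cong (c *_) (e b)

functional-basis : (h : B → ℚ) (b : B) → functional h (basis b) ≡ h b
functional-basis h b = trans (ℚ.+-identityʳ _) (ℚ.*-identityˡ _)

functional-• : (h : B → ℚ) (c : ℚ) (f : Span B) → functional h (c • f) ≡ c * functional h f
functional-• h c f = begin
  functional h (c • f)                       ≡⟨ ∑ℚ-map (weigh h) _ f ⟩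
  ∑ℚ f (λ (d , b) → (c * d) * h b)           ≡⟨ ∑ℚ-cong f (λ (d , b) → ℚ.*-assoc c d (h b)) ⟩
  ∑ℚ f (λ (d , b) → c * (d * h b))           ≡⟨ *-∑ℚ c (weigh h) f ⟨
  c * functional h f                         ∎

functional-linear : (h : C → ℚ) (k : B → Span C) (f : Span B) →
                    functional h (linear k f) ≡ functional (λ b → functional h (k b)) f
functional-linear h k f =
  trans (∑ℚ-concatMap (weigh h) _ f) (∑ℚ-cong f λ (c , b) → functional-• h c (k b))

functional-bilinear : (h : C → ℚ) (μ : A → B → Span C) (f : Span A) (g : Span B) →
  functional h (bilinear μ f g) ≡ functional (λ a → functional (λ b → functional h (μ a b)) g) f
functional-bilinear h μ f g =
  trans (functional-linear h _ f) (functional-cong f λ a → functional-linear h (μ a) g)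

functional-⊗ : (h : A × B → ℚ) (f : Span A) (g : Span B) →
  functional h (f ⊗ g) ≡ functional (λ a → functional (λ b → h (a , b)) g) f
functional-⊗ h f g = trans (functional-bilinear h _ f g)
  (functional-cong f λ a → functional-cong g λ b → functional-basis h (a , b))

functional-∑ : (h : B → ℚ) (xs : List A) (k : A → Span B) →
               functional h (∑ xs k) ≡ ∑ℚ xs (λ x → functional h (k x))
functional-∑ h xs k = ∑ℚ-concatMap (weigh h) k xs

functional-∑-• : (h : B → ℚ) (xs : List A) (c : A → ℚ) (k : A → Span B) →
  functional h (∑ xs (λ x → c x • k x)) ≡ ∑ℚ xs (λ x → c x * functional h (k x))
functional-∑-• h xs c k =
  trans (functional-∑ h xs _) (∑ℚ-cong xs λ x → functional-• h (c x) (k x))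

functional-* : (c : ℚ) (h : B → ℚ) (f : Span B) →
               functional (λ b → c * h b) f ≡ c * functional h f
functional-* c h f = trans (∑ℚ-cong f λ (d , b) → *-swap d c (h b)) (sym (*-∑ℚ c (weigh h) f))

functional-++ : (h : B → ℚ) (f g : Span B) → functional h (f ++ g) ≡ functional h f + functional h g
functional-++ h f g = ∑ℚ-++ (weigh h) f g

-- Kronecker deltas

module _ (_≟_ : DecidableEquality B) where

  δ-≡ : {b b′ : B} → b ≡ b′ → δ _≟_ b b′ ≡ 1ℚ
  δ-≡ {b} {b′} e with b ≟ b′
  ... | yes _ = refl
  ... | no ¬e = contradiction e ¬e

  δ-≢ : {b b′ : B} → b ≢ b′ → δ _≟_ b b′ ≡ 0ℚ
  δ-≢ {b} {b′} ¬e with b ≟ b′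
  ... | yes e = contradiction e ¬e
  ... | no _  = refl

  -- Makes the cofactor of a delta constant in the summation variable b′, after which it can leave
  -- the sum.
  δ-*-subst : (k : B → ℚ) (b b′ : B) → δ _≟_ b b′ * k b′ ≡ δ _≟_ b b′ * k b
  δ-*-subst k b b′ with b ≟ b′
  ... | yes refl = refl
  ... | no _     = trans (ℚ.*-zeroˡ (k b′)) (sym (ℚ.*-zeroˡ (k b)))

-- A delta depends only on whether the equality holds, so it can be transported along a
-- correspondence between different types, such as words and compositions.
δ-⇔ : (_≟ᵇ_ : DecidableEquality B) (_≟ᶜ_ : DecidableEquality C) {b b′ : B} {c c′ : C} →
      (b ≡ b′ ⇔ c ≡ c′) → δ _≟ᵇ_ b b′ ≡ δ _≟ᶜ_ c c′
δ-⇔ _≟ᵇ_ _≟ᶜ_ {b} {b′} e with b ≟ᵇ b′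
... | yes p = sym (δ-≡ _≟ᶜ_ (Equivalence.to e p))
... | no ¬p = sym (δ-≢ _≟ᶜ_ (¬p ∘ Equivalence.from e))

δ-× : (_≟ᵃ_ : DecidableEquality A) (_≟ᵇ_ : DecidableEquality B) (_≟ᶜ_ : DecidableEquality C)
      {a a′ : A} {b b′ : B} {c c′ : C} →
      (a ≡ a′ ⇔ (b ≡ b′ × c ≡ c′)) → δ _≟ᵃ_ a a′ ≡ δ _≟ᵇ_ b b′ * δ _≟ᶜ_ c c′
δ-× _≟ᵃ_ _≟ᵇ_ _≟ᶜ_ {a} {a′} {b} {b′} {c} {c′} e with b ≟ᵇ b′ | c ≟ᶜ c′
... | yes p | yes q = δ-≡ _≟ᵃ_ (Equivalence.from e (p , q))
... | yes p | no ¬q = δ-≢ _≟ᵃ_ (¬q ∘ proj₂ ∘ Equivalence.to e)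
... | no ¬p | yes q = δ-≢ _≟ᵃ_ (¬p ∘ proj₁ ∘ Equivalence.to e)
... | no ¬p | no ¬q = δ-≢ _≟ᵃ_ (¬p ∘ proj₁ ∘ Equivalence.to e)

δ-∷ : (_≟_ : DecidableEquality B) (b b′ : B) (bs bs′ : List B) →
      δ (List.≡-dec _≟_) (b ∷ bs) (b′ ∷ bs′) ≡ δ _≟_ b b′ * δ (List.≡-dec _≟_) bs bs′
δ-∷ _≟_ b b′ bs bs′ = δ-× (List.≡-dec _≟_) _≟_ (List.≡-dec _≟_)
  {b ∷ bs} {b′ ∷ bs′} {b} {b′} {bs} {bs′} (mk⇔ (λ { refl → refl , refl }) (λ { (refl , refl) → refl }))

-- Signs

sign-+ : ∀ m n → sign (m ℕ.+ n) ≡ sign m * sign n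
sign-+ zero    n = sym (ℚ.*-identityˡ _)
sign-+ (suc m) n = trans (cong -_ (sign-+ m n)) (ℚ.neg-distribˡ-* (sign m) (sign n))

sign² : ∀ n → sign n * sign n ≡ 1ℚ
sign² zero    = refl
sign² (suc n) = begin
  - sign n * - sign n      ≡⟨ ℚ.neg-distribˡ-* (sign n) _ ⟨
  - (sign n * - sign n)    ≡⟨ cong -_ (ℚ.neg-distribʳ-* (sign n) (sign n)) ⟨
  - - (sign n * sign n)    ≡⟨ cong (-_ ∘ -_) (sign² n) ⟩
  1ℚ                       ∎

-- Sums over antidiagonals

∑-upTo-suc : (f : ℕ → ℚ) (n : ℕ) →
             ∑ℚ (upTo (suc n)) f ≡ f 0 + ∑ℚ (upTo n) (f ∘ suc)
∑-upTo-suc f n = cong (f 0 +_) (begin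
  ∑ℚ (applyUpTo suc n) f       ≡⟨ cong (λ xs → ∑ℚ xs f) (List.map-upTo suc n) ⟨
  ∑ℚ (map suc (upTo n)) f      ≡⟨ ∑ℚ-map f suc (upTo n) ⟩
  ∑ℚ (upTo n) (f ∘ suc)        ∎)

∑-antidiagonal : (f : ℕ × ℕ → ℚ) (n : ℕ) →
                 ∑ℚ (antidiagonal n) f ≡ ∑ℚ (upTo (suc n)) (λ i → f (i , n ∸ i))
∑-antidiagonal f n = ∑ℚ-map f _ (upTo (suc n))

∑-antidiagonal-first : (f : ℕ × ℕ → ℚ) (n : ℕ) →
  ∑ℚ (antidiagonal (suc n)) f ≡ f (0 , suc n) + ∑ℚ (antidiagonal n) (λ (i , j) → f (suc i , j))
∑-antidiagonal-first f n = begin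
  ∑ℚ (antidiagonal (suc n)) f
    ≡⟨ ∑-antidiagonal f (suc n) ⟩
  ∑ℚ (upTo (suc (suc n))) (λ i → f (i , suc n ∸ i))
    ≡⟨ ∑-upTo-suc (λ i → f (i , suc n ∸ i)) (suc n) ⟩
  f (0 , suc n) + ∑ℚ (upTo (suc n)) (λ i → f (suc i , n ∸ i))
    ≡⟨ cong (f (0 , suc n) +_) (∑-antidiagonal (λ (i , j) → f (suc i , j)) n) ⟨
  f (0 , suc n) + ∑ℚ (antidiagonal n) (λ (i , j) → f (suc i , j))
    ∎

-- Derived from the version for the first pair, where `suc n ∸ suc i` reduces by computation;
-- treating the last pair directly would require facts about truncated subtraction.
∑-antidiagonal-last : (f : ℕ × ℕ → ℚ) (n : ℕ) →
  ∑ℚ (antidiagonal (suc n)) f ≡ ∑ℚ (antidiagonal n) (λ (i , j) → f (i , suc j)) + f (suc n , 0)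
∑-antidiagonal-last f zero    = sym (trans
  (ℚ.+-assoc (f (0 , 1)) 0ℚ (f (1 , 0)))
  (cong (f (0 , 1) +_) (ℚ.+-comm 0ℚ (f (1 , 0)))))
∑-antidiagonal-last f (suc n) = begin
  ∑ℚ (antidiagonal (suc (suc n))) f
    ≡⟨ ∑-antidiagonal-first f (suc n) ⟩
  f (0 , suc (suc n)) + ∑ℚ (antidiagonal (suc n)) (λ (i , j) → f (suc i , j))
    ≡⟨ cong (f (0 , suc (suc n)) +_) (∑-antidiagonal-last (λ (i , j) → f (suc i , j)) n) ⟩
  f (0 , suc (suc n)) + (∑ℚ (antidiagonal n) (λ (i , j) → f (suc i , suc j)) + f (suc (suc n) , 0))
    ≡⟨ ℚ.+-assoc (f (0 , suc (suc n))) _ _ ⟨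
  f (0 , suc (suc n)) + ∑ℚ (antidiagonal n) (λ (i , j) → f (suc i , suc j)) + f (suc (suc n) , 0)
    ≡⟨ cong (_+ f (suc (suc n) , 0)) (∑-antidiagonal-first (λ (i , j) → f (i , suc j)) n) ⟨
  ∑ℚ (antidiagonal (suc n)) (λ (i , j) → f (i , suc j)) + f (suc (suc n) , 0)
    ∎

∑-antidiagonal-swap : (f : ℕ × ℕ → ℚ) (n : ℕ) →
  ∑ℚ (antidiagonal n) f ≡ ∑ℚ (antidiagonal n) (λ (i , j) → f (j , i))
∑-antidiagonal-swap f zero    = refl
∑-antidiagonal-swap f (suc n) = begin
  ∑ℚ (antidiagonal (suc n)) f
    ≡⟨ ∑-antidiagonal-first f n ⟩
  f (0 , suc n) + ∑ℚ (antidiagonal n) (λ (i , j) → f (suc i , j))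
    ≡⟨ cong (f (0 , suc n) +_) (∑-antidiagonal-swap (λ (i , j) → f (suc i , j)) n) ⟩
  f (0 , suc n) + ∑ℚ (antidiagonal n) (λ (i , j) → f (suc j , i))
    ≡⟨ ℚ.+-comm (f (0 , suc n)) _ ⟩
  ∑ℚ (antidiagonal n) (λ (i , j) → f (suc j , i)) + f (0 , suc n)
    ≡⟨ ∑-antidiagonal-last (λ (i , j) → f (j , i)) n ⟨
  ∑ℚ (antidiagonal (suc n)) (λ (i , j) → f (j , i))
    ∎

-- Lowering i by one drops the pair with first coordinate 0, which cannot match, until the point
-- sought is itself that first pair.
∑-antidiagonal-δ : ∀ i j {n} → i ℕ.+ j ≡ n →
  ∑ℚ (antidiagonal n) (λ (i′ , j′) → δ ℕ._≟_ i i′ * δ ℕ._≟_ j j′) ≡ 1ℚ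
∑-antidiagonal-δ zero    zero    refl = refl
∑-antidiagonal-δ zero    (suc j) refl = begin
  ∑ℚ (antidiagonal (suc j)) (λ (i′ , j′) → δ ℕ._≟_ 0 i′ * δ ℕ._≟_ (suc j) j′)
    ≡⟨ ∑-antidiagonal-first (λ (i′ , j′) → δ ℕ._≟_ 0 i′ * δ ℕ._≟_ (suc j) j′) j ⟩
  1ℚ * δ ℕ._≟_ (suc j) (suc j) + ∑ℚ (antidiagonal j) (λ (_ , j′) → 0ℚ * δ ℕ._≟_ (suc j) j′)
    ≡⟨ cong₂ (λ x y → 1ℚ * x + y) (δ-≡ ℕ._≟_ {suc j} refl)
         (trans (∑ℚ-cong (antidiagonal j) λ (_ , j′) → ℚ.*-zeroˡ (δ ℕ._≟_ (suc j) j′)) (∑ℚ-zero (antidiagonal j))) ⟩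
  1ℚ
    ∎
∑-antidiagonal-δ (suc i) j       refl = begin
  ∑ℚ (antidiagonal (suc (i ℕ.+ j))) (λ (i′ , j′) → δ ℕ._≟_ (suc i) i′ * δ ℕ._≟_ j j′)
    ≡⟨ ∑-antidiagonal-first (λ (i′ , j′) → δ ℕ._≟_ (suc i) i′ * δ ℕ._≟_ j j′) (i ℕ.+ j) ⟩
  0ℚ * δ ℕ._≟_ j (suc (i ℕ.+ j)) + ∑ℚ (antidiagonal (i ℕ.+ j)) (λ (i′ , j′) → δ ℕ._≟_ i i′ * δ ℕ._≟_ j j′)
    ≡⟨ cong₂ _+_ (ℚ.*-zeroˡ (δ ℕ._≟_ j (suc (i ℕ.+ j)))) (∑-antidiagonal-δ i j refl) ⟩
  1ℚ
    ∎

-- Dotted compositions of a given degree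

ferm-++ : ∀ α β → ferm (α ++ β) ≡ ferm α ℕ.+ ferm β
ferm-++ []                 β = refl
ferm-++ (plain[1+ _ ] ∷ α) β = ferm-++ α β
ferm-++ (dotted[ _ ]  ∷ α) β = cong suc (ferm-++ α β)

deg-++ : ∀ α β → deg (α ++ β) ≡ deg α ℕ.+ deg β
deg-++ []                 β = refl
deg-++ (plain[1+ m ] ∷ α) β = trans (cong (suc m ℕ.+_) (deg-++ α β)) (sym (ℕ.+-assoc (suc m) _ _))
deg-++ (dotted[ m ]  ∷ α) β = trans (cong (suc m ℕ.+_) (deg-++ α β)) (sym (ℕ.+-assoc (suc m) _ _))

-- A copy of the local function in the definition of ofDegree.
grow : DComp → List DComp
grow []      = (plain[1+ 0 ] ∷ []) ∷ (dotted[ 0 ] ∷ []) ∷ []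
grow (p ∷ α) = (plain[1+ 0 ] ∷ p ∷ α) ∷ (dotted[ 0 ] ∷ p ∷ α) ∷ (increment p ∷ α) ∷ []

ofDegree-suc : ∀ n → ofDegree (suc n) ≡ concatMap grow (ofDegree n)
ofDegree-suc n = List.concatMap-cong (λ { [] → refl ; (_ ∷ _) → refl }) (ofDegree n)

-- The inverse of `grow`: the parent from which `p ∷ α` arises.
shrink : Part → DComp → DComp
shrink plain[1+ zero ]  α = α
shrink plain[1+ suc m ] α = plain[1+ m ] ∷ α
shrink dotted[ zero ]   α = α
shrink dotted[ suc m ]  α = dotted[ m ] ∷ α

deg-shrink : ∀ p α → deg (p ∷ α) ≡ suc (deg (shrink p α))
deg-shrink plain[1+ zero ]  α = refl
deg-shrink plain[1+ suc m ] α = refl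
deg-shrink dotted[ zero ]   α = refl
deg-shrink dotted[ suc m ]  α = refl

δ-increment : ∀ p q α β → δ _≟ᴰ_ (increment p ∷ α) (increment q ∷ β) ≡ δ _≟ᴰ_ (p ∷ α) (q ∷ β)
δ-increment p q α β = δ-⇔ _≟ᴰ_ _≟ᴰ_
  {increment p ∷ α} {increment q ∷ β} {p ∷ α} {q ∷ β} (mk⇔ (to p q) λ { refl → refl })
  where
  to : ∀ p q → increment p ∷ α ≡ increment q ∷ β → p ∷ α ≡ q ∷ β
  to plain[1+ m ] plain[1+ _ ] refl = refl
  to dotted[ m ]  dotted[ _ ]  refl = refl

∑-grow-[] : ∀ γ → ∑ℚ (grow γ) (δ _≟ᴰ_ []) ≡ 0ℚ
∑-grow-[] []      = refl
∑-grow-[] (_ ∷ _) = refl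

0+0+x+0 : ∀ x → 0ℚ + (0ℚ + (x + 0ℚ)) ≡ x
0+0+x+0 = solve 1 (λ x → con 0ℚ :+ (con 0ℚ :+ (x :+ con 0ℚ)) := x) refl

0+x+0+0 : ∀ x → 0ℚ + (x + (0ℚ + 0ℚ)) ≡ x
0+x+0+0 = solve 1 (λ x → con 0ℚ :+ (x :+ (con 0ℚ :+ con 0ℚ)) := x) refl

-- A nonempty composition has a single parent, and its first part tells which child it is: 1, dotted
-- 0, or an increment. The head of γ is split only to let `increment` compute inside the delta.
∑-grow : ∀ p α γ → ∑ℚ (grow γ) (δ _≟ᴰ_ (p ∷ α)) ≡ δ _≟ᴰ_ (shrink p α) γ
∑-grow plain[1+ zero ]  α []                   = ℚ.+-identityʳ _
∑-grow plain[1+ zero ]  α (plain[1+ _ ] ∷ γ)   = ℚ.+-identityʳ _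
∑-grow plain[1+ zero ]  α (dotted[ _ ] ∷ γ)    = ℚ.+-identityʳ _
∑-grow plain[1+ suc m ] α []                   = refl
∑-grow plain[1+ suc m ] α (q@(plain[1+ _ ]) ∷ γ) = trans (0+0+x+0 _) (δ-increment plain[1+ m ] q α γ)
∑-grow plain[1+ suc m ] α (q@(dotted[ _ ]) ∷ γ)  = trans (0+0+x+0 _) (δ-increment plain[1+ m ] q α γ)
∑-grow dotted[ zero ]   α []                   = trans (ℚ.+-identityˡ _) (ℚ.+-identityʳ _)
∑-grow dotted[ zero ]   α (plain[1+ _ ] ∷ γ)   = 0+x+0+0 _
∑-grow dotted[ zero ]   α (dotted[ _ ] ∷ γ)    = 0+x+0+0 _
∑-grow dotted[ suc m ]  α []                   = refl
∑-grow dotted[ suc m ]  α (q@(plain[1+ _ ]) ∷ γ) = trans (0+0+x+0 _) (δ-increment dotted[ m ] q α γ)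
∑-grow dotted[ suc m ]  α (q@(dotted[ _ ]) ∷ γ)  = trans (0+0+x+0 _) (δ-increment dotted[ m ] q α γ)

-- The children of the compositions of degree n partition those of degree n + 1, so uniqueness
-- passes from `shrink p α` to `p ∷ α`.
multiplicity-ofDegree : ∀ n α → ∑ℚ (ofDegree n) (δ _≟ᴰ_ α) ≡ δ ℕ._≟_ (deg α) n
multiplicity-ofDegree zero [] = refl
-- The rewrite exhibits the degree as a successor, so that its comparison with 0 computes.
multiplicity-ofDegree zero (p ∷ α) rewrite deg-shrink p α = refl
multiplicity-ofDegree (suc n) [] = begin
  ∑ℚ (ofDegree (suc n)) (δ _≟ᴰ_ [])
    ≡⟨ cong (λ xs → ∑ℚ xs (δ _≟ᴰ_ [])) (ofDegree-suc n) ⟩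
  ∑ℚ (concatMap grow (ofDegree n)) (δ _≟ᴰ_ [])
    ≡⟨ ∑ℚ-concatMap (δ _≟ᴰ_ []) grow (ofDegree n) ⟩
  ∑ℚ (ofDegree n) (λ γ → ∑ℚ (grow γ) (δ _≟ᴰ_ []))
    ≡⟨ ∑ℚ-cong (ofDegree n) ∑-grow-[] ⟩
  ∑ℚ (ofDegree n) (λ _ → 0ℚ)
    ≡⟨ ∑ℚ-zero (ofDegree n) ⟩
  0ℚ
    ∎
multiplicity-ofDegree (suc n) (p ∷ α) = begin
  ∑ℚ (ofDegree (suc n)) (δ _≟ᴰ_ (p ∷ α))
    ≡⟨ cong (λ xs → ∑ℚ xs (δ _≟ᴰ_ (p ∷ α))) (ofDegree-suc n) ⟩
  ∑ℚ (concatMap grow (ofDegree n)) (δ _≟ᴰ_ (p ∷ α))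
    ≡⟨ ∑ℚ-concatMap (δ _≟ᴰ_ (p ∷ α)) grow (ofDegree n) ⟩
  ∑ℚ (ofDegree n) (λ γ → ∑ℚ (grow γ) (δ _≟ᴰ_ (p ∷ α)))
    ≡⟨ ∑ℚ-cong (ofDegree n) (∑-grow p α) ⟩
  ∑ℚ (ofDegree n) (δ _≟ᴰ_ (shrink p α))
    ≡⟨ multiplicity-ofDegree n (shrink p α) ⟩
  δ ℕ._≟_ (suc (deg (shrink p α))) (suc n)
    ≡⟨ cong (λ d → δ ℕ._≟_ d (suc n)) (deg-shrink p α) ⟨
  δ ℕ._≟_ (deg (p ∷ α)) (suc n)
    ∎

∑-ofDegree : ∀ n α (k : DComp → ℚ) →
  ∑ℚ (ofDegree n) (λ γ → δ _≟ᴰ_ α γ * k γ) ≡ δ ℕ._≟_ (deg α) n * k α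
∑-ofDegree n α k = begin
  ∑ℚ (ofDegree n) (λ γ → δ _≟ᴰ_ α γ * k γ)  ≡⟨ ∑ℚ-cong (ofDegree n) (δ-*-subst _≟ᴰ_ k α) ⟩
  ∑ℚ (ofDegree n) (λ γ → δ _≟ᴰ_ α γ * k α)  ≡⟨ ∑ℚ-* (δ _≟ᴰ_ α) (k α) (ofDegree n) ⟨
  ∑ℚ (ofDegree n) (δ _≟ᴰ_ α) * k α          ≡⟨ cong (_* k α) (multiplicity-ofDegree n α) ⟩
  δ ℕ._≟_ (deg α) n * k α                   ∎

-- Each inner sum leaves the indicator of one degree, and the antidiagonal of n meets the point (deg
-- α , deg β) exactly once.
∑-ofDegree² : ∀ n α β (k : DComp → DComp → ℚ) → deg α ℕ.+ deg β ≡ n →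
  ∑ℚ (antidiagonal n) (λ (i , j) → ∑ℚ (ofDegree i) λ α′ → ∑ℚ (ofDegree j) λ β′ →
    δ _≟ᴰ_ α α′ * δ _≟ᴰ_ β β′ * k α′ β′) ≡ k α β
∑-ofDegree² n α β k e = begin
  ∑ℚ (antidiagonal n) (λ (i , j) → ∑ℚ (ofDegree i) λ α′ → ∑ℚ (ofDegree j) λ β′ →
    δ _≟ᴰ_ α α′ * δ _≟ᴰ_ β β′ * k α′ β′)
    ≡⟨ ∑ℚ-cong (antidiagonal n) (λ (i , j) → trans
         (∑ℚ-cong (ofDegree i) λ α′ → inner j α′)
         (∑-ofDegree i α λ α′ → δ ℕ._≟_ (deg β) j * k α′ β)) ⟩
  ∑ℚ (antidiagonal n) (λ (i , j) → δ ℕ._≟_ (deg α) i * (δ ℕ._≟_ (deg β) j * k α β))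
    ≡⟨ ∑ℚ-cong (antidiagonal n) (λ (i , j) → ℚ.*-assoc (δ ℕ._≟_ (deg α) i) (δ ℕ._≟_ (deg β) j) (k α β)) ⟨
  ∑ℚ (antidiagonal n) (λ (i , j) → δ ℕ._≟_ (deg α) i * δ ℕ._≟_ (deg β) j * k α β)
    ≡⟨ ∑ℚ-* (λ (i , j) → δ ℕ._≟_ (deg α) i * δ ℕ._≟_ (deg β) j) (k α β) (antidiagonal n) ⟨
  ∑ℚ (antidiagonal n) (λ (i , j) → δ ℕ._≟_ (deg α) i * δ ℕ._≟_ (deg β) j) * k α β
    ≡⟨ cong (_* k α β) (∑-antidiagonal-δ (deg α) (deg β) e) ⟩
  1ℚ * k α β
    ≡⟨ ℚ.*-identityˡ _ ⟩
  k α β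
    ∎
  where
  inner : ∀ j α′ → ∑ℚ (ofDegree j) (λ β′ → δ _≟ᴰ_ α α′ * δ _≟ᴰ_ β β′ * k α′ β′)
                 ≡ δ _≟ᴰ_ α α′ * (δ ℕ._≟_ (deg β) j * k α′ β)
  inner j α′ = begin
    ∑ℚ (ofDegree j) (λ β′ → δ _≟ᴰ_ α α′ * δ _≟ᴰ_ β β′ * k α′ β′)
      ≡⟨ ∑ℚ-cong (ofDegree j) (λ β′ → ℚ.*-assoc (δ _≟ᴰ_ α α′) (δ _≟ᴰ_ β β′) (k α′ β′)) ⟩
    ∑ℚ (ofDegree j) (λ β′ → δ _≟ᴰ_ α α′ * (δ _≟ᴰ_ β β′ * k α′ β′))
      ≡⟨ *-∑ℚ (δ _≟ᴰ_ α α′) (λ β′ → δ _≟ᴰ_ β β′ * k α′ β′) (ofDegree j) ⟨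
    δ _≟ᴰ_ α α′ * ∑ℚ (ofDegree j) (λ β′ → δ _≟ᴰ_ β β′ * k α′ β′)
      ≡⟨ cong (δ _≟ᴰ_ α α′ *_) (∑-ofDegree j β (k α′)) ⟩
    δ _≟ᴰ_ α α′ * (δ ℕ._≟_ (deg β) j * k α′ β)
      ∎

-- The pairing and the product of sNSym

⟨Hᴰ,⟩ : ∀ α a → ⟨ Hᴰ α , a ⟩ ≡ functional (δ _≟ᴰ_ α) a
⟨Hᴰ,⟩ α a = functional-basis (λ α → functional (δ _≟ᴰ_ α) a) α

⟨Hᴰ,M⟩ : ∀ α β → ⟨ Hᴰ α , M β ⟩ ≡ δ _≟ᴰ_ α β
⟨Hᴰ,M⟩ α β = trans (⟨Hᴰ,⟩ α (M β)) (functional-basis (δ _≟ᴰ_ α) β)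

basis⊗basis : (h : A × B → ℚ) (a : A) (b : B) → functional h (basis a ⊗ basis b) ≡ h (a , b)
basis⊗basis h a b = begin
  functional h (basis a ⊗ basis b)
    ≡⟨ functional-⊗ h (basis a) (basis b) ⟩
  functional (λ a → functional (λ b → h (a , b)) (basis b)) (basis a)
    ≡⟨ functional-basis (λ a → functional (λ b → h (a , b)) (basis b)) a ⟩
  functional (λ b → h (a , b)) (basis b)
    ≡⟨ functional-basis (λ b → h (a , b)) b ⟩
  h (a , b)
    ∎

-- The sign is written with α where the pairing has γ; the delta permits this, and the sign becomes
-- constant in the argument of the functional.
pairing₂ : DComp → DComp → DComp × DComp → ℚ
pairing₂ α β (γ , ε) = sign (ferm β ℕ.* ferm α) * (δ _≟ᴰ_ α γ * δ _≟ᴰ_ β ε)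

⟨Hᴰ⊗Hᴰ,⟩₂ : ∀ α β a → ⟨ Hᴰ α ⊗ Hᴰ β , a ⟩₂ ≡ functional (pairing₂ α β) a
⟨Hᴰ⊗Hᴰ,⟩₂ α β a = trans
  (basis⊗basis (λ (α , β) → functional (λ (γ , ε) →
     sign (ferm β ℕ.* ferm γ) * (⟨ Hᴰ α , M γ ⟩ * ⟨ Hᴰ β , M ε ⟩)) a) α β)
  (functional-cong a λ (γ , ε) → begin
    sign (ferm β ℕ.* ferm γ) * (⟨ Hᴰ α , M γ ⟩ * ⟨ Hᴰ β , M ε ⟩)
      ≡⟨ cong₂ (λ x y → sign (ferm β ℕ.* ferm γ) * (x * y)) (⟨Hᴰ,M⟩ α γ) (⟨Hᴰ,M⟩ β ε) ⟩
    sign (ferm β ℕ.* ferm γ) * (δ _≟ᴰ_ α γ * δ _≟ᴰ_ β ε)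
      ≡⟨ *-swap (sign (ferm β ℕ.* ferm γ)) (δ _≟ᴰ_ α γ) (δ _≟ᴰ_ β ε) ⟩
    δ _≟ᴰ_ α γ * (sign (ferm β ℕ.* ferm γ) * δ _≟ᴰ_ β ε)
      ≡⟨ δ-*-subst _≟ᴰ_ (λ γ → sign (ferm β ℕ.* ferm γ) * δ _≟ᴰ_ β ε) α γ ⟩
    δ _≟ᴰ_ α γ * (sign (ferm β ℕ.* ferm α) * δ _≟ᴰ_ β ε)
      ≡⟨ *-swap (δ _≟ᴰ_ α γ) (sign (ferm β ℕ.* ferm α)) (δ _≟ᴰ_ β ε) ⟩
    pairing₂ α β (γ , ε)
      ∎)

-- At most one cut of γ can contribute, the one after `length α` parts. The recursion removes equal
-- heads, and the cut at 0 counts only once α is exhausted.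
∑-deconcatenations : ∀ α β γ →
  ∑ℚ (upTo (suc (length γ))) (λ k → δ _≟ᴰ_ α (take k γ) * δ _≟ᴰ_ β (drop k γ)) ≡ δ _≟ᴰ_ (α ++ β) γ
∑-deconcatenations [] β [] = trans (ℚ.+-identityʳ _) (ℚ.*-identityˡ _)
∑-deconcatenations [] β (q ∷ γ) = begin
  ∑ℚ (upTo (suc (suc (length γ)))) f
    ≡⟨ ∑-upTo-suc f (suc (length γ)) ⟩
  1ℚ * δ _≟ᴰ_ β (q ∷ γ) + ∑ℚ (upTo (suc (length γ))) (λ k → 0ℚ * δ _≟ᴰ_ β (drop k γ))
    ≡⟨ cong₂ _+_ (ℚ.*-identityˡ (δ _≟ᴰ_ β (q ∷ γ))) (trans
         (∑ℚ-cong (upTo (suc (length γ))) λ k → ℚ.*-zeroˡ (δ _≟ᴰ_ β (drop k γ)))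
         (∑ℚ-zero (upTo (suc (length γ))))) ⟩
  δ _≟ᴰ_ β (q ∷ γ) + 0ℚ
    ≡⟨ ℚ.+-identityʳ _ ⟩
  δ _≟ᴰ_ β (q ∷ γ)
    ∎
  where
  f : ℕ → ℚ
  f k = δ _≟ᴰ_ [] (take k (q ∷ γ)) * δ _≟ᴰ_ β (drop k (q ∷ γ))
∑-deconcatenations (p ∷ α) β [] = trans (ℚ.+-identityʳ _) (ℚ.*-zeroˡ (δ _≟ᴰ_ β []))
∑-deconcatenations (p ∷ α) β (q ∷ γ) = begin
  ∑ℚ (upTo (suc (suc (length γ)))) f
    ≡⟨ ∑-upTo-suc f (suc (length γ)) ⟩
  0ℚ * δ _≟ᴰ_ β (q ∷ γ) + ∑ℚ (upTo (suc (length γ))) (f ∘ suc)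
    ≡⟨ cong₂ _+_ (ℚ.*-zeroˡ (δ _≟ᴰ_ β (q ∷ γ))) (∑ℚ-cong (upTo (suc (length γ))) λ k → trans
         (cong (_* δ _≟ᴰ_ β (drop k γ)) (δ-∷ _≟ᴾ_ p q α (take k γ)))
         (ℚ.*-assoc (δ _≟ᴾ_ p q) (δ _≟ᴰ_ α (take k γ)) (δ _≟ᴰ_ β (drop k γ)))) ⟩
  0ℚ + ∑ℚ (upTo (suc (length γ))) (λ k → δ _≟ᴾ_ p q * g k)
    ≡⟨ ℚ.+-identityˡ _ ⟩
  ∑ℚ (upTo (suc (length γ))) (λ k → δ _≟ᴾ_ p q * g k)
    ≡⟨ *-∑ℚ (δ _≟ᴾ_ p q) g (upTo (suc (length γ))) ⟨
  δ _≟ᴾ_ p q * ∑ℚ (upTo (suc (length γ))) g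
    ≡⟨ cong (δ _≟ᴾ_ p q *_) (∑-deconcatenations α β γ) ⟩
  δ _≟ᴾ_ p q * δ _≟ᴰ_ (α ++ β) γ
    ≡⟨ δ-∷ _≟ᴾ_ p q (α ++ β) γ ⟨
  δ _≟ᴰ_ (p ∷ α ++ β) (q ∷ γ)
    ∎
  where
  f g : ℕ → ℚ
  f k = δ _≟ᴰ_ (p ∷ α) (take k (q ∷ γ)) * δ _≟ᴰ_ β (drop k (q ∷ γ))
  g k = δ _≟ᴰ_ α (take k γ) * δ _≟ᴰ_ β (drop k γ)

⟨Hᴰ⊗Hᴰ,M-coproduct⟩₂ : ∀ α β γ →
  ⟨ Hᴰ α ⊗ Hᴰ β , M-coproduct γ ⟩₂ ≡ sign (ferm β ℕ.* ferm α) * δ _≟ᴰ_ (α ++ β) γ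
⟨Hᴰ⊗Hᴰ,M-coproduct⟩₂ α β γ = begin
  ⟨ Hᴰ α ⊗ Hᴰ β , M-coproduct γ ⟩₂
    ≡⟨ ⟨Hᴰ⊗Hᴰ,⟩₂ α β (M-coproduct γ) ⟩
  functional (pairing₂ α β) (M-coproduct γ)
    ≡⟨ functional-∑ (pairing₂ α β) ks (λ k → M (take k γ) ⊗ M (drop k γ)) ⟩
  ∑ℚ ks (λ k → functional (pairing₂ α β) (M (take k γ) ⊗ M (drop k γ)))
    ≡⟨ ∑ℚ-cong ks (λ k → basis⊗basis (pairing₂ α β) (take k γ) (drop k γ)) ⟩
  ∑ℚ ks (λ k → sign (ferm β ℕ.* ferm α) * (δ _≟ᴰ_ α (take k γ) * δ _≟ᴰ_ β (drop k γ)))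
    ≡⟨ *-∑ℚ (sign (ferm β ℕ.* ferm α)) (λ k → δ _≟ᴰ_ α (take k γ) * δ _≟ᴰ_ β (drop k γ)) ks ⟨
  sign (ferm β ℕ.* ferm α) * ∑ℚ ks (λ k → δ _≟ᴰ_ α (take k γ) * δ _≟ᴰ_ β (drop k γ))
    ≡⟨ cong (sign (ferm β ℕ.* ferm α) *_) (∑-deconcatenations α β γ) ⟩
  sign (ferm β ℕ.* ferm α) * δ _≟ᴰ_ (α ++ β) γ
    ∎
  where ks = upTo (suc (length γ))

-- Additivity of the degree places `α ++ β` in the enumerated range, where it occurs once; every
-- other γ pairs to zero.
functional-H-product : ∀ (h : DComp → ℚ) α β →
  functional h (H-product α β) ≡ sign (ferm α ℕ.* ferm β) * h (α ++ β)
functional-H-product h α β = begin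
  functional h (H-product α β)
    ≡⟨ functional-∑-• h (ofDegree n) (λ γ → ⟨ Hᴰ α ⊗ Hᴰ β , M-coproduct γ ⟩₂) Hᴰ ⟩
  ∑ℚ (ofDegree n) (λ γ → ⟨ Hᴰ α ⊗ Hᴰ β , M-coproduct γ ⟩₂ * functional h (Hᴰ γ))
    ≡⟨ ∑ℚ-cong (ofDegree n) (λ γ → cong₂ _*_ (⟨Hᴰ⊗Hᴰ,M-coproduct⟩₂ α β γ) (functional-basis h γ)) ⟩
  ∑ℚ (ofDegree n) (λ γ → s * δ _≟ᴰ_ (α ++ β) γ * h γ)
    ≡⟨ ∑ℚ-cong (ofDegree n) (λ γ → ℚ.*-assoc s (δ _≟ᴰ_ (α ++ β) γ) (h γ)) ⟩
  ∑ℚ (ofDegree n) (λ γ → s * (δ _≟ᴰ_ (α ++ β) γ * h γ))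
    ≡⟨ *-∑ℚ s (λ γ → δ _≟ᴰ_ (α ++ β) γ * h γ) (ofDegree n) ⟨
  s * ∑ℚ (ofDegree n) (λ γ → δ _≟ᴰ_ (α ++ β) γ * h γ)
    ≡⟨ cong (s *_) (∑-ofDegree n (α ++ β) h) ⟩
  s * (δ ℕ._≟_ (deg (α ++ β)) n * h (α ++ β))
    ≡⟨ cong (λ x → s * (x * h (α ++ β))) (δ-≡ ℕ._≟_ (deg-++ α β)) ⟩
  s * (1ℚ * h (α ++ β))
    ≡⟨ cong (s *_) (ℚ.*-identityˡ _) ⟩
  s * h (α ++ β)
    ≡⟨ cong (λ m → sign m * h (α ++ β)) (ℕ.*-comm (ferm β) (ferm α)) ⟩
  sign (ferm α ℕ.* ferm β) * h (α ++ β)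
    ∎
  where
  n = deg α ℕ.+ deg β
  s = sign (ferm β ℕ.* ferm α)

-- Monomials

strippedLetter : Letter → DComp
strippedLetter (false , zero)  = []
strippedLetter (false , suc m) = plain[1+ m ] ∷ []
strippedLetter (true  , m)     = dotted[ m ] ∷ []

-- Reads off the index of the monomial quasisymmetric function in which a given monomial occurs,
-- whatever gaps it has between its variables.
strip : Mono → DComp
strip = concatMap strippedLetter

strip-leading : ∀ α → strip (leading α) ≡ α
strip-leading []                 = refl
strip-leading (plain[1+ m ] ∷ α) = cong (plain[1+ m ] ∷_) (strip-leading α)
strip-leading (dotted[ m ] ∷ α)  = cong (dotted[ m ] ∷_) (strip-leading α)

ferm-strip : ∀ u → ferm (strip u) ≡ #θ u
ferm-strip []                  = refl
ferm-strip ((false , zero) ∷ u)  = ferm-strip u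
ferm-strip ((false , suc _) ∷ u) = ferm-strip u
ferm-strip ((true , _) ∷ u)      = cong suc (ferm-strip u)

_≟ᴸ_ : DecidableEquality Letter
_≟ᴸ_ = Product.≡-dec Bool._≟_ ℕ._≟_

∑-map-∷ : (a b : Letter) (us : List Mono) (w : Mono) →
  ∑ℚ (map (a ∷_) us) (λ u → δ _≟ᴹ_ u (b ∷ w)) ≡ δ _≟ᴸ_ a b * ∑ℚ us (λ u → δ _≟ᴹ_ u w)
∑-map-∷ a b us w = begin
  ∑ℚ (map (a ∷_) us) (λ u → δ _≟ᴹ_ u (b ∷ w))
    ≡⟨ ∑ℚ-map (λ u → δ _≟ᴹ_ u (b ∷ w)) (a ∷_) us ⟩
  ∑ℚ us (λ u → δ _≟ᴹ_ (a ∷ u) (b ∷ w))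
    ≡⟨ ∑ℚ-cong us (λ u → δ-∷ _≟ᴸ_ a b u w) ⟩
  ∑ℚ us (λ u → δ _≟ᴸ_ a b * δ _≟ᴹ_ u w)
    ≡⟨ *-∑ℚ (δ _≟ᴸ_ a b) (λ u → δ _≟ᴹ_ u w) us ⟨
  δ _≟ᴸ_ a b * ∑ℚ us (λ u → δ _≟ᴹ_ u w)
    ∎

δ-letter : ∀ p q → δ _≟ᴸ_ (letter p) (letter q) ≡ δ _≟ᴾ_ q p
δ-letter p q = δ-⇔ _≟ᴸ_ _≟ᴾ_ {letter p} {letter q} {q} {p} (mk⇔ (to p q) λ { refl → refl })
  where
  to : ∀ p q → letter p ≡ letter q → q ≡ p
  to plain[1+ _ ] plain[1+ _ ] refl = refl
  to dotted[ _ ]  dotted[ _ ]  refl = refl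

δ-letter-trivial : ∀ p → δ _≟ᴸ_ (letter p) trivial ≡ 0ℚ
δ-letter-trivial plain[1+ _ ] = refl
δ-letter-trivial dotted[ _ ]  = refl

δ-trivial-letter : ∀ p → δ _≟ᴸ_ trivial (letter p) ≡ 0ℚ
δ-trivial-letter plain[1+ _ ] = refl
δ-trivial-letter dotted[ _ ]  = refl

-- Separates the gaps from the letters that come from parts, which are the two cases in the
-- recursion of `placements`.
data LetterView : Letter → Set where
  isTrivial : LetterView trivial
  isLetter  : ∀ p → LetterView (letter p)

letterView : ∀ a → LetterView a
letterView (false , zero)  = isTrivial
letterView (false , suc m) = isLetter plain[1+ m ]
letterView (true , m)      = isLetter dotted[ m ]

strip-letter-∷ : ∀ p u → strip (letter p ∷ u) ≡ p ∷ strip u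
strip-letter-∷ plain[1+ _ ] u = refl
strip-letter-∷ dotted[ _ ]  u = refl

-- A monomial determines the positions of its nontrivial letters, so it occurs in one M_α only, and
-- there through one placement. The first letter of w decides which of the two kinds of placement
-- can match.
monomialSeries-strip : ∀ α w → monomialSeries α w ≡ δ _≟ᴰ_ (strip w) α
monomialSeries-strip []      []      = refl
monomialSeries-strip (p ∷ α) []      = refl
monomialSeries-strip []      (b ∷ w) = trans
  (trans (ℚ.+-identityʳ _) (δ-∷ _≟ᴸ_ trivial b (replicate (length w) trivial) w)) (by (letterView b))
  where
  IH : δ _≟ᴹ_ (replicate (length w) trivial) w ≡ δ _≟ᴰ_ (strip w) []
  IH = trans (sym (ℚ.+-identityʳ _)) (monomialSeries-strip [] w)
  by : ∀ {b} → LetterView b →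
       δ _≟ᴸ_ trivial b * δ _≟ᴹ_ (replicate (length w) trivial) w ≡ δ _≟ᴰ_ (strip (b ∷ w)) []
  by isTrivial    = trans (ℚ.*-identityˡ _) IH
  by (isLetter q) rewrite δ-trivial-letter q | strip-letter-∷ q w = ℚ.*-zeroˡ (δ _≟ᴹ_ (replicate (length w) trivial) w)
monomialSeries-strip (p ∷ α) (b ∷ w) = begin
  monomialSeries (p ∷ α) (b ∷ w)
    ≡⟨ ∑ℚ-++ (λ u → δ _≟ᴹ_ u (b ∷ w)) (map (letter p ∷_) (placements α n)) _ ⟩
  ∑ℚ (map (letter p ∷_) (placements α n)) (λ u → δ _≟ᴹ_ u (b ∷ w))
    + ∑ℚ (map (trivial ∷_) (placements (p ∷ α) n)) (λ u → δ _≟ᴹ_ u (b ∷ w))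
    ≡⟨ cong₂ _+_ (∑-map-∷ (letter p) b (placements α n) w)
                 (∑-map-∷ trivial b (placements (p ∷ α) n) w) ⟩
  δ _≟ᴸ_ (letter p) b * monomialSeries α w + δ _≟ᴸ_ trivial b * monomialSeries (p ∷ α) w
    ≡⟨ cong₂ (λ x y → δ _≟ᴸ_ (letter p) b * x + δ _≟ᴸ_ trivial b * y)
         (monomialSeries-strip α w) (monomialSeries-strip (p ∷ α) w) ⟩
  δ _≟ᴸ_ (letter p) b * δ _≟ᴰ_ (strip w) α + δ _≟ᴸ_ trivial b * δ _≟ᴰ_ (strip w) (p ∷ α)
    ≡⟨ by (letterView b) ⟩
  δ _≟ᴰ_ (strip (b ∷ w)) (p ∷ α)
    ∎
  where
  n = length w
  by : ∀ {b} → LetterView b →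
       δ _≟ᴸ_ (letter p) b * δ _≟ᴰ_ (strip w) α + δ _≟ᴸ_ trivial b * δ _≟ᴰ_ (strip w) (p ∷ α)
       ≡ δ _≟ᴰ_ (strip (b ∷ w)) (p ∷ α)
  by isTrivial rewrite δ-letter-trivial p =
    trans (cong₂ _+_ (ℚ.*-zeroˡ (δ _≟ᴰ_ (strip w) α)) (ℚ.*-identityˡ (δ _≟ᴰ_ (strip w) (p ∷ α))))
          (ℚ.+-identityˡ (δ _≟ᴰ_ (strip w) (p ∷ α)))
  by (isLetter q) rewrite δ-trivial-letter q | strip-letter-∷ q w | δ-letter p q = trans
    (cong (δ _≟ᴾ_ q p * δ _≟ᴰ_ (strip w) α +_) (ℚ.*-zeroˡ (δ _≟ᴰ_ (strip w) (p ∷ α))))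
    (trans (ℚ.+-identityʳ _) (sym (δ-∷ _≟ᴾ_ q p (strip w) α)))

-- The coproduct of sNSym

-- No constructor puts a θ on both sides, which reflects θ² = 0. The relation keeps the additivity
-- of exponents that degree counts need and offers exactly the cases of the sign comparison.
data LetterSplit : Letter → Letter → Letter → Set where
  even : ∀ {i j n} → i ℕ.+ j ≡ n → LetterSplit (false , n) (false , i) (false , j)
  oddˡ : ∀ {i j n} → i ℕ.+ j ≡ n → LetterSplit (true  , n) (true  , i) (false , j)
  oddʳ : ∀ {i j n} → i ℕ.+ j ≡ n → LetterSplit (true  , n) (false , i) (true  , j)

data Split : Mono → Mono → Mono → Set where
  []  : Split [] [] []
  _∷_ : ∀ {a b c w u v} → LetterSplit a b c → Split w u v → Split (a ∷ w) (b ∷ u) (c ∷ v)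

antidiagonal-+ : ∀ n → All (λ (i , j) → i ℕ.+ j ≡ n) (antidiagonal n)
antidiagonal-+ n = All.map⁺ (All.applyUpTo⁺₁ id (suc n) λ { (ℕ.s≤s i≤n) → ℕ.m+[n∸m]≡n i≤n })

letterFactorisations-split : ∀ a → All (λ (b , c) → LetterSplit a b c) (letterFactorisations a)
letterFactorisations-split (false , n) =
  All.++⁺ (All.map⁺ (All.map even (antidiagonal-+ n))) []
letterFactorisations-split (true , n) =
  All.++⁺ (All.map⁺ (All.map oddˡ (antidiagonal-+ n)))
          (All.++⁺ (All.map⁺ (All.map oddʳ (antidiagonal-+ n))) [])

factorisations-split : ∀ w → All (λ (u , v) → Split w u v) (factorisations w)
factorisations-split []      = [] ∷ []
factorisations-split (a ∷ w) = All.concat⁺ (All.map⁺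
  (All.map (λ s → All.map⁺ (All.map (s ∷_) (factorisations-split w)))
           (letterFactorisations-split a)))

∑-factorisations-∷ : ∀ (f : Mono × Mono → ℚ) a w →
  ∑ℚ (factorisations (a ∷ w)) f ≡
  ∑ℚ (letterFactorisations a) λ (b , c) → ∑ℚ (factorisations w) λ (u , v) → f (b ∷ u , c ∷ v)
∑-factorisations-∷ f a w =
  trans (∑ℚ-concatMap f _ (letterFactorisations a))
        (∑ℚ-cong (letterFactorisations a) λ (b , c) → ∑ℚ-map f _ (factorisations w))

#θ-split : ∀ {w u v} → Split w u v → #θ w ≡ #θ u ℕ.+ #θ v
#θ-split []           = refl
#θ-split (even _ ∷ s) = #θ-split s
#θ-split (oddˡ _ ∷ s) = cong suc (#θ-split s)
#θ-split {u = _ ∷ u} {_ ∷ v} (oddʳ _ ∷ s) = trans (cong suc (#θ-split s)) (sym (ℕ.+-suc (#θ u) (#θ v)))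

letterDegree : Letter → ℕ
letterDegree (false , n) = n
letterDegree (true  , n) = suc n

deg-strip-∷ : ∀ a u → deg (strip (a ∷ u)) ≡ letterDegree a ℕ.+ deg (strip u)
deg-strip-∷ (false , zero)  u = refl
deg-strip-∷ (false , suc _) u = refl
deg-strip-∷ (true , _)      u = refl

letterDegree-split : ∀ {a b c} → LetterSplit a b c → letterDegree b ℕ.+ letterDegree c ≡ letterDegree a
letterDegree-split (even e)         = e
letterDegree-split (oddˡ e)         = cong suc e
letterDegree-split (oddʳ {i} {j} e) = trans (ℕ.+-suc i j) (cong suc e)

deg-split : ∀ {w u v} → Split w u v → deg (strip u) ℕ.+ deg (strip v) ≡ deg (strip w)
deg-split [] = refl
deg-split (_∷_ {a} {b} {c} {w} {u} {v} s ss) = begin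
  deg (strip (b ∷ u)) ℕ.+ deg (strip (c ∷ v))
    ≡⟨ cong₂ ℕ._+_ (deg-strip-∷ b u) (deg-strip-∷ c v) ⟩
  (letterDegree b ℕ.+ deg (strip u)) ℕ.+ (letterDegree c ℕ.+ deg (strip v))
    ≡⟨ ℕ-+.interchange (letterDegree b) (deg (strip u)) (letterDegree c) (deg (strip v)) ⟩
  (letterDegree b ℕ.+ letterDegree c) ℕ.+ (deg (strip u) ℕ.+ deg (strip v))
    ≡⟨ cong₂ ℕ._+_ (letterDegree-split s) (deg-split ss) ⟩
  letterDegree a ℕ.+ deg (strip w)
    ≡⟨ deg-strip-∷ a w ⟨
  deg (strip (a ∷ w))
    ∎

-- The degree indicator comes from the range of summation in `M-product`. It turns into 1 later,
-- once α and β are the two halves of a factorisation of the leading monomial of M_γ.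
⟨Hᴰ,M-product⟩ : ∀ α β γ → ⟨ Hᴰ γ , M-product α β ⟩ ≡
  δ ℕ._≟_ (deg γ) (deg α ℕ.+ deg β) * (monomialSeries α ⋆ monomialSeries β) (leading γ)
⟨Hᴰ,M-product⟩ α β γ = begin
  ⟨ Hᴰ γ , M-product α β ⟩
    ≡⟨ ⟨Hᴰ,⟩ γ (M-product α β) ⟩
  functional (δ _≟ᴰ_ γ) (M-product α β)
    ≡⟨ functional-∑-• (δ _≟ᴰ_ γ) (ofDegree n) c M ⟩
  ∑ℚ (ofDegree n) (λ ε → c ε * functional (δ _≟ᴰ_ γ) (M ε))
    ≡⟨ ∑ℚ-cong (ofDegree n) (λ ε → trans (cong (c ε *_) (functional-basis (δ _≟ᴰ_ γ) ε))
                                         (ℚ.*-comm (c ε) (δ _≟ᴰ_ γ ε))) ⟩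
  ∑ℚ (ofDegree n) (λ ε → δ _≟ᴰ_ γ ε * c ε)
    ≡⟨ ∑-ofDegree n γ c ⟩
  δ ℕ._≟_ (deg γ) n * c γ
    ∎
  where
  n = deg α ℕ.+ deg β
  c : DComp → ℚ
  c ε = (monomialSeries α ⋆ monomialSeries β) (leading ε)

pairing-sign : ∀ α β → ⟨ Hᴰ α ⊗ Hᴰ β , M α ⊗ M β ⟩₂ ≡ sign (ferm β ℕ.* ferm α)
pairing-sign α β = begin
  ⟨ Hᴰ α ⊗ Hᴰ β , M α ⊗ M β ⟩₂
    ≡⟨ ⟨Hᴰ⊗Hᴰ,⟩₂ α β (M α ⊗ M β) ⟩
  functional (pairing₂ α β) (M α ⊗ M β)
    ≡⟨ basis⊗basis (pairing₂ α β) α β ⟩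
  sign (ferm β ℕ.* ferm α) * (δ _≟ᴰ_ α α * δ _≟ᴰ_ β β)
    ≡⟨ cong₂ (λ x y → sign (ferm β ℕ.* ferm α) * (x * y)) (δ-≡ _≟ᴰ_ {α} refl) (δ-≡ _≟ᴰ_ {β} refl) ⟩
  sign (ferm β ℕ.* ferm α) * 1ℚ
    ≡⟨ ℚ.*-identityʳ _ ⟩
  sign (ferm β ℕ.* ferm α)
    ∎

-- The value at h of Δ H_γ, for w the leading monomial of M_γ: a factorisation
-- u v of w contributes H_α ⊗ H_β for the one pair α, β with u in M_α and v in
-- M_β, with the sign of u v = ± w times that of ⟨ H_α ⊗ H_β , M_α ⊗ M_β ⟩.
splitSum : (DComp × DComp → ℚ) → Mono → ℚ
splitSum h w = ∑ℚ (factorisations w) λ (u , v) →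
  sign (inversions u v ℕ.+ #θ v ℕ.* #θ u) * h (strip u , strip v)

functional-H-coproduct : ∀ h γ → functional h (H-coproduct γ) ≡ splitSum h (leading γ)
functional-H-coproduct h γ = begin
  functional h (H-coproduct γ)
    ≡⟨ functional-∑ h (antidiagonal (deg γ)) (λ (i , j) →
         ∑ (cartesianProduct (ofDegree i) (ofDegree j)) λ (α , β) → c α β • (Hᴰ α ⊗ Hᴰ β)) ⟩
  ∑ℚ (antidiagonal (deg γ)) (λ (i , j) → functional h
    (∑ (cartesianProduct (ofDegree i) (ofDegree j)) λ (α , β) → c α β • (Hᴰ α ⊗ Hᴰ β)))
    ≡⟨ ∑ℚ-cong (antidiagonal (deg γ)) (λ (i , j) → trans
         (functional-∑-• h (cartesianProduct (ofDegree i) (ofDegree j))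
            (λ (α , β) → c α β) (λ (α , β) → Hᴰ α ⊗ Hᴰ β))
         (∑ℚ-cartesianProduct (λ (α , β) → c α β * functional h (Hᴰ α ⊗ Hᴰ β)) (ofDegree i) (ofDegree j))) ⟩
  ∑∑ (λ α β → c α β * functional h (Hᴰ α ⊗ Hᴰ β))
    ≡⟨ ∑∑-cong expand ⟩
  ∑∑ (λ α β → ∑ℚ fs λ (u , v) → δ _≟ᴰ_ (strip u) α * δ _≟ᴰ_ (strip v) β * k u v α β)
    -- With the factorisation outermost, the two deltas select a single pair α, β for each one.
    ≡⟨ ∑∑-swap (λ α β (u , v) → δ _≟ᴰ_ (strip u) α * δ _≟ᴰ_ (strip v) β * k u v α β) ⟩
  ∑ℚ fs (λ (u , v) → ∑∑ λ α β → δ _≟ᴰ_ (strip u) α * δ _≟ᴰ_ (strip v) β * k u v α β)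
    -- The selected pair lies in the range of summation only if its degrees add up to `deg γ`, which
    -- is known for genuine factorisations.
    ≡⟨ ∑ℚ-cong-All (All.map (λ {(u , v)} s → collapse u v (deg-split′ s)) (factorisations-split (leading γ))) ⟩
  splitSum h (leading γ)
    ∎
  where
  fs = factorisations (leading γ)

  c : DComp → DComp → ℚ
  c α β = ⟨ Hᴰ α ⊗ Hᴰ β , M α ⊗ M β ⟩₂ * ⟨ Hᴰ γ , M-product α β ⟩

  ∑∑ : (DComp → DComp → ℚ) → ℚ
  ∑∑ f = ∑ℚ (antidiagonal (deg γ)) λ (i , j) → ∑ℚ (ofDegree i) λ α → ∑ℚ (ofDegree j) λ β → f α β

  ∑∑-cong : ∀ {f g} → (∀ α β → f α β ≡ g α β) → ∑∑ f ≡ ∑∑ g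
  ∑∑-cong e = ∑ℚ-cong (antidiagonal (deg γ)) λ (i , j) →
    ∑ℚ-cong (ofDegree i) λ α → ∑ℚ-cong (ofDegree j) λ β → e α β

  ∑∑-swap : (f : DComp → DComp → Mono × Mono → ℚ) →
            ∑∑ (λ α β → ∑ℚ fs (f α β)) ≡ ∑ℚ fs (λ uv → ∑∑ (λ α β → f α β uv))
  ∑∑-swap f = trans
    (∑ℚ-cong (antidiagonal (deg γ)) λ (i , j) → trans
      (∑ℚ-cong (ofDegree i) λ α → ∑ℚ-swap (λ β uv → f α β uv) (ofDegree j) fs)
      (∑ℚ-swap (λ α uv → ∑ℚ (ofDegree j) λ β → f α β uv) (ofDegree i) fs))
    (∑ℚ-swap (λ (i , j) uv → ∑ℚ (ofDegree i) λ α → ∑ℚ (ofDegree j) λ β → f α β uv)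
      (antidiagonal (deg γ)) fs)

  deg-split′ : ∀ {u v} → Split (leading γ) u v → deg (strip u) ℕ.+ deg (strip v) ≡ deg γ
  deg-split′ s = trans (deg-split s) (cong deg (strip-leading γ))

  k : Mono → Mono → DComp → DComp → ℚ
  k u v α β = sign (inversions u v) *
    (sign (ferm β ℕ.* ferm α) * δ ℕ._≟_ (deg γ) (deg α ℕ.+ deg β) * h (α , β))

  rearrange : ∀ s d i x y h → (s * d) * (i * (x * y)) * h ≡ x * y * (i * (s * d * h))
  rearrange = solve 6 (λ s d i x y h →
    (s :* d) :* (i :* (x :* y)) :* h := x :* y :* (i :* (s :* d :* h))) refl

  expand : ∀ α β → c α β * functional h (Hᴰ α ⊗ Hᴰ β) ≡
    ∑ℚ fs (λ (u , v) → δ _≟ᴰ_ (strip u) α * δ _≟ᴰ_ (strip v) β * k u v α β)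
  expand α β = begin
    c α β * functional h (Hᴰ α ⊗ Hᴰ β)
      ≡⟨ cong₂ _*_ (cong₂ _*_ (pairing-sign α β) (⟨Hᴰ,M-product⟩ α β γ)) (basis⊗basis h α β) ⟩
    s * (d * (monomialSeries α ⋆ monomialSeries β) (leading γ)) * h (α , β)
      ≡⟨ cong (_* h (α , β)) (ℚ.*-assoc s d _) ⟨
    s * d * (monomialSeries α ⋆ monomialSeries β) (leading γ) * h (α , β)
      ≡⟨ cong (_* h (α , β)) (*-∑ℚ (s * d) _ fs) ⟩
    ∑ℚ fs (λ (u , v) → s * d * (sign (inversions u v) * (monomialSeries α u * monomialSeries β v))) * h (α , β)
      ≡⟨ ∑ℚ-* (λ (u , v) → s * d * (sign (inversions u v) * (monomialSeries α u * monomialSeries β v))) (h (α , β)) fs ⟩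
    ∑ℚ fs (λ (u , v) → s * d * (sign (inversions u v) * (monomialSeries α u * monomialSeries β v)) * h (α , β))
      ≡⟨ ∑ℚ-cong fs (λ (u , v) → trans
           (cong₂ (λ x y → s * d * (sign (inversions u v) * (x * y)) * h (α , β))
             (monomialSeries-strip α u) (monomialSeries-strip β v))
           (rearrange s d (sign (inversions u v)) (δ _≟ᴰ_ (strip u) α) (δ _≟ᴰ_ (strip v) β) (h (α , β)))) ⟩
    ∑ℚ fs (λ (u , v) → δ _≟ᴰ_ (strip u) α * δ _≟ᴰ_ (strip v) β * k u v α β)
      ∎
    where
    s = sign (ferm β ℕ.* ferm α)
    d = δ ℕ._≟_ (deg γ) (deg α ℕ.+ deg β)

  collapse : ∀ u v → deg (strip u) ℕ.+ deg (strip v) ≡ deg γ →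
    ∑∑ (λ α β → δ _≟ᴰ_ (strip u) α * δ _≟ᴰ_ (strip v) β * k u v α β) ≡
    sign (inversions u v ℕ.+ #θ v ℕ.* #θ u) * h (strip u , strip v)
  collapse u v e = begin
    ∑∑ (λ α β → δ _≟ᴰ_ (strip u) α * δ _≟ᴰ_ (strip v) β * k u v α β)
      ≡⟨ ∑-ofDegree² (deg γ) (strip u) (strip v) (k u v) e ⟩
    sign (inversions u v) * (sign (ferm (strip v) ℕ.* ferm (strip u))
      * δ ℕ._≟_ (deg γ) (deg (strip u) ℕ.+ deg (strip v)) * h (strip u , strip v))
      ≡⟨ cong₂ (λ m x → sign (inversions u v) * (sign m * x * h (strip u , strip v)))
           (cong₂ ℕ._*_ (ferm-strip v) (ferm-strip u)) (δ-≡ ℕ._≟_ (sym e)) ⟩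
    sign (inversions u v) * (sign (#θ v ℕ.* #θ u) * 1ℚ * h (strip u , strip v))
      ≡⟨ cong (λ x → sign (inversions u v) * (x * h (strip u , strip v))) (ℚ.*-identityʳ (sign (#θ v ℕ.* #θ u))) ⟩
    sign (inversions u v) * (sign (#θ v ℕ.* #θ u) * h (strip u , strip v))
      ≡⟨ ℚ.*-assoc (sign (inversions u v)) _ _ ⟨
    sign (inversions u v) * sign (#θ v ℕ.* #θ u) * h (strip u , strip v)
      ≡⟨ cong (_* h (strip u , strip v)) (sign-+ (inversions u v) (#θ v ℕ.* #θ u)) ⟨
    sign (inversions u v ℕ.+ #θ v ℕ.* #θ u) * h (strip u , strip v)
      ∎

-- Words in the generators

part : Generator → Part
part `H[1+ m ] = plain[1+ m ]
part `H̃[ n ]   = dotted[ n ]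

generator : Part → Generator
generator plain[1+ m ] = `H[1+ m ]
generator dotted[ n ]  = `H̃[ n ]

composition : Word → DComp
composition = map part

word : DComp → Word
word = map generator

composition-word : ∀ α → composition (word α) ≡ α
composition-word []                 = refl
composition-word (plain[1+ _ ] ∷ α) = cong (_ ∷_) (composition-word α)
composition-word (dotted[ _ ] ∷ α)  = cong (_ ∷_) (composition-word α)

word-composition : ∀ w → word (composition w) ≡ w
word-composition []              = refl
word-composition (`H[1+ _ ] ∷ w) = cong (_ ∷_) (word-composition w)
word-composition (`H̃[ _ ] ∷ w)   = cong (_ ∷_) (word-composition w)

ferm-composition : ∀ w → ferm (composition w) ≡ fermWord w
ferm-composition []              = refl
ferm-composition (`H[1+ _ ] ∷ w) = ferm-composition w
ferm-composition (`H̃[ _ ] ∷ w)   = cong suc (ferm-composition w)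

#θ-leading : ∀ w → #θ (leading (composition w)) ≡ fermWord w
#θ-leading []              = refl
#θ-leading (`H[1+ _ ] ∷ w) = #θ-leading w
#θ-leading (`H̃[ _ ] ∷ w)   = cong suc (#θ-leading w)

fermWord-∷ : ∀ g w → fermWord (g ∷ w) ≡ fermWord (g ∷ []) ℕ.+ fermWord w
fermWord-∷ `H[1+ _ ] w = refl
fermWord-∷ `H̃[ _ ]   w = refl

fermWord-++ : ∀ u v → fermWord (u ++ v) ≡ fermWord u ℕ.+ fermWord v
fermWord-++ []              v = refl
fermWord-++ (`H[1+ _ ] ∷ u) v = fermWord-++ u v
fermWord-++ (`H̃[ _ ] ∷ u)   v = cong suc (fermWord-++ u v)

-- evaluateWord w = wordSign w · H_α for α = composition w.
wordSign : Word → ℚ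
wordSign []      = 1ℚ
wordSign (g ∷ w) = sign (fermWord (g ∷ []) ℕ.* fermWord w) * wordSign w

wordSign² : ∀ w → wordSign w * wordSign w ≡ 1ℚ
wordSign² []      = refl
wordSign² (g ∷ w) = begin
  (s * wordSign w) * (s * wordSign w)    ≡⟨ *-interchange s (wordSign w) s (wordSign w) ⟩
  (s * s) * (wordSign w * wordSign w)    ≡⟨ cong₂ _*_ (sign² (fermWord (g ∷ []) ℕ.* fermWord w)) (wordSign² w) ⟩
  1ℚ                                     ∎
  where s = sign (fermWord (g ∷ []) ℕ.* fermWord w)

-- The exponent of `wordSign` counts the pairs of dotted generators in a word, and concatenation
-- adds the pairs with one member in u and one in v. This is the sign content of the
-- multiplicativity of `evaluate`.
wordSign-++ : ∀ u v → wordSign (u ++ v) ≡ wordSign u * wordSign v * sign (fermWord u ℕ.* fermWord v)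
wordSign-++ []      v = sym (trans (ℚ.*-identityʳ (1ℚ * wordSign v)) (ℚ.*-identityˡ (wordSign v)))
wordSign-++ (g ∷ u) v = begin
  sign (e ℕ.* fermWord (u ++ v)) * wordSign (u ++ v)
    ≡⟨ cong₂ _*_ (cong (λ m → sign (e ℕ.* m)) (fermWord-++ u v)) (wordSign-++ u v) ⟩
  sign (e ℕ.* (U ℕ.+ V)) * (wordSign u * wordSign v * sign (U ℕ.* V))
    ≡⟨ cong (λ m → sign m * (wordSign u * wordSign v * sign (U ℕ.* V))) (ℕ.*-distribˡ-+ e U V) ⟩
  sign (e ℕ.* U ℕ.+ e ℕ.* V) * (wordSign u * wordSign v * sign (U ℕ.* V))
    ≡⟨ cong (_* (wordSign u * wordSign v * sign (U ℕ.* V))) (sign-+ (e ℕ.* U) (e ℕ.* V)) ⟩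
  sign (e ℕ.* U) * sign (e ℕ.* V) * (wordSign u * wordSign v * sign (U ℕ.* V))
    ≡⟨ rearrange (sign (e ℕ.* U)) (sign (e ℕ.* V)) (wordSign u) (wordSign v) (sign (U ℕ.* V)) ⟩
  sign (e ℕ.* U) * wordSign u * wordSign v * (sign (e ℕ.* V) * sign (U ℕ.* V))
    ≡⟨ cong (sign (e ℕ.* U) * wordSign u * wordSign v *_) (sign-+ (e ℕ.* V) (U ℕ.* V)) ⟨
  sign (e ℕ.* U) * wordSign u * wordSign v * sign (e ℕ.* V ℕ.+ U ℕ.* V)
    ≡⟨ cong (λ m → wordSign (g ∷ u) * wordSign v * sign m)
         (trans (cong (ℕ._* V) (fermWord-∷ g u)) (ℕ.*-distribʳ-+ V e U)) ⟨
  wordSign (g ∷ u) * wordSign v * sign (fermWord (g ∷ u) ℕ.* V)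
    ∎
  where
  e = fermWord (g ∷ [])
  U = fermWord u
  V = fermWord v
  rearrange : ∀ a b c d f → a * b * (c * d * f) ≡ a * c * d * (b * f)
  rearrange = solve 5 (λ a b c d f → a :* b :* (c :* d :* f) := a :* c :* d :* (b :* f)) refl

generatorImage-basis : ∀ g → generatorImage g ≡ Hᴰ (part g ∷ [])
generatorImage-basis `H[1+ _ ] = refl
generatorImage-basis `H̃[ _ ]   = refl

functional-evaluateWord : ∀ h w → functional h (evaluateWord w) ≡ wordSign w * h (composition w)
functional-evaluateWord h []      = ℚ.+-identityʳ (1ℚ * h [])
functional-evaluateWord h (g ∷ w) = begin
  functional h (generatorImage g SNSym.· evaluateWord w)
    ≡⟨ functional-bilinear h H-product (generatorImage g) (evaluateWord w) ⟩
  functional K (generatorImage g)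
    ≡⟨ cong (functional K) (generatorImage-basis g) ⟩
  functional K (Hᴰ (part g ∷ []))
    ≡⟨ functional-basis K (part g ∷ []) ⟩
  functional (λ β → functional h (H-product (part g ∷ []) β)) (evaluateWord w)
    ≡⟨ functional-cong (evaluateWord w) (functional-H-product h (part g ∷ [])) ⟩
  functional (λ β → sign (ferm (part g ∷ []) ℕ.* ferm β) * h (part g ∷ β)) (evaluateWord w)
    -- The induction hypothesis is applied to a new functional, which absorbs the first part and its
    -- sign.
    ≡⟨ functional-evaluateWord (λ β → sign (ferm (part g ∷ []) ℕ.* ferm β) * h (part g ∷ β)) w ⟩
  wordSign w * (sign (ferm (part g ∷ []) ℕ.* ferm (composition w)) * h (part g ∷ composition w))
    ≡⟨ cong₂ (λ m n → wordSign w * (sign (m ℕ.* n) * h (part g ∷ composition w)))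
         (ferm-composition (g ∷ [])) (ferm-composition w) ⟩
  wordSign w * (s * h (part g ∷ composition w))
    ≡⟨ *-swap (wordSign w) s (h (part g ∷ composition w)) ⟩
  s * (wordSign w * h (part g ∷ composition w))
    ≡⟨ ℚ.*-assoc s (wordSign w) (h (part g ∷ composition w)) ⟨
  s * wordSign w * h (part g ∷ composition w)
    ∎
  where
  K : DComp → ℚ
  K α = functional (λ β → functional h (H-product α β)) (evaluateWord w)
  s = sign (fermWord (g ∷ []) ℕ.* fermWord w)

functional-evaluate : ∀ h f →
  functional h (evaluate f) ≡ functional (λ w → wordSign w * h (composition w)) f
functional-evaluate h f =
  trans (functional-linear h evaluateWord f) (functional-cong f (functional-evaluateWord h))

functional-evaluateWord-⊗ : ∀ h u v → functional h (evaluateWord u ⊗ evaluateWord v) ≡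
  wordSign u * wordSign v * h (composition u , composition v)
functional-evaluateWord-⊗ h u v = begin
  functional h (evaluateWord u ⊗ evaluateWord v)
    ≡⟨ functional-⊗ h (evaluateWord u) (evaluateWord v) ⟩
  functional (λ α → functional (λ β → h (α , β)) (evaluateWord v)) (evaluateWord u)
    ≡⟨ functional-evaluateWord (λ α → functional (λ β → h (α , β)) (evaluateWord v)) u ⟩
  wordSign u * functional (λ β → h (composition u , β)) (evaluateWord v)
    ≡⟨ cong (wordSign u *_) (functional-evaluateWord (λ β → h (composition u , β)) v) ⟩
  wordSign u * (wordSign v * h (composition u , composition v))
    ≡⟨ ℚ.*-assoc (wordSign u) (wordSign v) _ ⟨
  wordSign u * wordSign v * h (composition u , composition v)
    ∎

-- The coproduct on words

∑-letterFactorisations-plain : ∀ (f : Letter × Letter → ℚ) n →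
  ∑ℚ (letterFactorisations (false , n)) f ≡
  ∑ℚ (antidiagonal n) (λ (i , j) → f ((false , i) , (false , j)))
∑-letterFactorisations-plain f n = begin
  ∑ℚ (letterFactorisations (false , n)) f
    ≡⟨ cong (λ xs → ∑ℚ xs f) (List.++-identityʳ (map _ (antidiagonal n))) ⟩
  ∑ℚ (map _ (antidiagonal n)) f
    ≡⟨ ∑ℚ-map f _ (antidiagonal n) ⟩
  ∑ℚ (antidiagonal n) (λ (i , j) → f ((false , i) , (false , j)))
    ∎

∑-letterFactorisations-dotted : ∀ (f : Letter × Letter → ℚ) n →
  ∑ℚ (letterFactorisations (true , n)) f ≡
  ∑ℚ (antidiagonal n) (λ (k , l) → f ((true , k) , (false , l)) + f ((false , l) , (true , k)))
∑-letterFactorisations-dotted f n = begin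
  ∑ℚ (letterFactorisations (true , n)) f
    ≡⟨ ∑ℚ-++ f (map _ (antidiagonal n)) (map _ (antidiagonal n) ++ []) ⟩
  ∑ℚ (map _ (antidiagonal n)) f + ∑ℚ (map _ (antidiagonal n) ++ []) f
    ≡⟨ cong₂ _+_ (∑ℚ-map f _ (antidiagonal n)) (trans
         (cong (λ xs → ∑ℚ xs f) (List.++-identityʳ (map _ (antidiagonal n))))
         (∑ℚ-map f _ (antidiagonal n))) ⟩
  ∑ℚ (antidiagonal n) (λ (k , l) → f ((true , k) , (false , l)))
    + ∑ℚ (antidiagonal n) (λ (l , k) → f ((false , l) , (true , k)))
    -- A factorisation lists the exponent of the left factor first, whereas the coproduct formula
    -- lists that of the dotted factor first; the second family must be reflected.
    ≡⟨ cong (∑ℚ (antidiagonal n) (λ (k , l) → f ((true , k) , (false , l))) +_)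
         (∑-antidiagonal-swap (λ (l , k) → f ((false , l) , (true , k))) n) ⟩
  ∑ℚ (antidiagonal n) (λ (k , l) → f ((true , k) , (false , l)))
    + ∑ℚ (antidiagonal n) (λ (k , l) → f ((false , l) , (true , k)))
    ≡⟨ ∑ℚ-+ (λ (k , l) → f ((true , k) , (false , l))) (λ (k , l) → f ((false , l) , (true , k)))
         (antidiagonal n) ⟨
  ∑ℚ (antidiagonal n) (λ (k , l) → f ((true , k) , (false , l)) + f ((false , l) , (true , k)))
    ∎

wordOfLetter : Letter → Word
wordOfLetter a = word (strippedLetter a)

`H-basis : ∀ i → `H i ≡ basis (wordOfLetter (false , i))
`H-basis zero    = refl
`H-basis (suc _) = refl

-- Brings the generator formula to the index set of `splitSum`. The convention H₀ = 1 corresponds to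
-- the trivial letter, whose word is empty.
functional-ΔGenerator : ∀ (k : Word × Word → ℚ) g →
  functional k (ΔGenerator g) ≡
  ∑ℚ (letterFactorisations (letter (part g))) (λ (b , c) → k (wordOfLetter b , wordOfLetter c))
functional-ΔGenerator k `H[1+ m ] = begin
  functional k (∑ (antidiagonal (suc m)) λ (i , j) → `H i ⊗ `H j)
    ≡⟨ functional-∑ k (antidiagonal (suc m)) (λ (i , j) → `H i ⊗ `H j) ⟩
  ∑ℚ (antidiagonal (suc m)) (λ (i , j) → functional k (`H i ⊗ `H j))
    ≡⟨ ∑ℚ-cong (antidiagonal (suc m)) (λ (i , j) → trans
         (cong₂ (λ x y → functional k (x ⊗ y)) (`H-basis i) (`H-basis j))
         (basis⊗basis k (wordOfLetter (false , i)) (wordOfLetter (false , j)))) ⟩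
  ∑ℚ (antidiagonal (suc m)) (λ (i , j) → k (wordOfLetter (false , i) , wordOfLetter (false , j)))
    ≡⟨ ∑-letterFactorisations-plain (λ (b , c) → k (wordOfLetter b , wordOfLetter c)) (suc m) ⟨
  ∑ℚ (letterFactorisations (false , suc m)) (λ (b , c) → k (wordOfLetter b , wordOfLetter c))
    ∎
functional-ΔGenerator k `H̃[ n ] = begin
  functional k (∑ (antidiagonal n) λ (i , l) → `H̃ i ⊗ `H l ⊞ `H l ⊗ `H̃ i)
    ≡⟨ functional-∑ k (antidiagonal n) (λ (i , l) → `H̃ i ⊗ `H l ⊞ `H l ⊗ `H̃ i) ⟩
  ∑ℚ (antidiagonal n) (λ (i , l) → functional k (`H̃ i ⊗ `H l ⊞ `H l ⊗ `H̃ i))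
    ≡⟨ ∑ℚ-cong (antidiagonal n) (λ (i , l) → trans
         (functional-++ k (`H̃ i ⊗ `H l) (`H l ⊗ `H̃ i))
         (trans (cong (λ x → functional k (`H̃ i ⊗ x) + functional k (x ⊗ `H̃ i)) (`H-basis l))
           (cong₂ _+_ (basis⊗basis k (wordOfLetter (true , i)) (wordOfLetter (false , l)))
                      (basis⊗basis k (wordOfLetter (false , l)) (wordOfLetter (true , i)))))) ⟩
  ∑ℚ (antidiagonal n) (λ (i , l) → k (wordOfLetter (true , i) , wordOfLetter (false , l))
                                 + k (wordOfLetter (false , l) , wordOfLetter (true , i)))
    ≡⟨ ∑-letterFactorisations-dotted (λ (b , c) → k (wordOfLetter b , wordOfLetter c)) n ⟨
  ∑ℚ (letterFactorisations (true , n)) (λ (b , c) → k (wordOfLetter b , wordOfLetter c))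
    ∎

ΔWord : Word → FreeAlgebra⊗FreeAlgebra
ΔWord = foldr (λ g t → ΔGenerator g Free.·₂ t) Free.𝟙₂

functional-·₂ : ∀ (k : Word × Word → ℚ) s t → functional k (s Free.·₂ t) ≡
  functional (λ (u₁ , v₁) → functional (λ (u₂ , v₂) →
    sign (fermWord v₁ ℕ.* fermWord u₂) * k (u₁ ++ u₂ , v₁ ++ v₂)) t) s
functional-·₂ k s t = trans
  (functional-bilinear k (λ (u₁ , v₁) (u₂ , v₂) →
     sign (fermWord v₁ ℕ.* fermWord u₂) • (basis (u₁ ++ u₂) ⊗ basis (v₁ ++ v₂))) s t)
  (functional-cong s λ (u₁ , v₁) → functional-cong t λ (u₂ , v₂) → trans
    (functional-• k (sign (fermWord v₁ ℕ.* fermWord u₂)) (basis (u₁ ++ u₂) ⊗ basis (v₁ ++ v₂)))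
    (cong (sign (fermWord v₁ ℕ.* fermWord u₂) *_) (basis⊗basis k (u₁ ++ u₂) (v₁ ++ v₂))))

-- Comparison of signs, one letter at a time

η : Letter → ℕ
η a = #θ (a ∷ [])

fermWord-wordOfLetter : ∀ a → fermWord (wordOfLetter a) ≡ η a
fermWord-wordOfLetter (false , zero)  = refl
fermWord-wordOfLetter (false , suc _) = refl
fermWord-wordOfLetter (true , _)      = refl

wordSign-wordOfLetter : ∀ a → wordSign (wordOfLetter a) ≡ 1ℚ
wordSign-wordOfLetter (false , zero)  = refl
wordSign-wordOfLetter (false , suc _) = refl
wordSign-wordOfLetter (true , _)      = refl

-- Formulated for letters because one side of a split may be trivial and then prepends nothing; the
-- exponent is 0 in that case.
wordSign-wordOfLetter-++ : ∀ a u →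
  wordSign (wordOfLetter a ++ u) ≡ wordSign u * sign (η a ℕ.* ferm (composition u))
wordSign-wordOfLetter-++ a u = begin
  wordSign (wordOfLetter a ++ u)
    ≡⟨ wordSign-++ (wordOfLetter a) u ⟩
  wordSign (wordOfLetter a) * wordSign u * sign (fermWord (wordOfLetter a) ℕ.* fermWord u)
    ≡⟨ cong₂ (λ x m → x * wordSign u * sign (m ℕ.* fermWord u))
         (wordSign-wordOfLetter a) (fermWord-wordOfLetter a) ⟩
  1ℚ * wordSign u * sign (η a ℕ.* fermWord u)
    ≡⟨ cong₂ (λ x m → x * sign (η a ℕ.* m)) (ℚ.*-identityˡ (wordSign u)) (sym (ferm-composition u)) ⟩
  wordSign u * sign (η a ℕ.* ferm (composition u))
    ∎

composition-wordOfLetter-++ : ∀ a u → composition (wordOfLetter a ++ u) ≡ strippedLetter a ++ composition u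
composition-wordOfLetter-++ a u = trans (List.map-++ part (wordOfLetter a) u)
  (cong (_++ composition u) (composition-word (strippedLetter a)))

sign-+-double : ∀ {m n} k → m ≡ n ℕ.+ (k ℕ.+ k) → sign m ≡ sign n
sign-+-double {m} {n} k e = begin
  sign m                       ≡⟨ cong sign e ⟩
  sign (n ℕ.+ (k ℕ.+ k))       ≡⟨ sign-+ n (k ℕ.+ k) ⟩
  sign n * sign (k ℕ.+ k)      ≡⟨ cong (sign n *_) (trans (sign-+ k k) (sign² k)) ⟩
  sign n * 1ℚ                  ≡⟨ ℚ.*-identityʳ (sign n) ⟩
  sign n                       ∎

-- The exponent of the sign in (H_b ⊗ H_c)(H_α ⊗ H_β) = ± H_{bα} ⊗ H_{cβ}, for
-- α and β of fermionic degrees U and V: the exchange of c with α, and the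
-- products H_b H_α = ± H_{bα} and H_c H_β = ± H_{cβ}.
koszul : Letter → Letter → ℕ → ℕ → ℕ
koszul b c U V = η c ℕ.* U ℕ.+ (η b ℕ.* U ℕ.+ η c ℕ.* V)

-- A θ sent to the left stands before all others and creates no inversion, while the pairing
-- exponent grows by `#θ v`. A θ sent to the right crosses the θ's of u, and the pairing exponent
-- grows by `#θ u`. With the contribution of `wordSign`, the excess over `koszul` is twice `#θ v` or
-- twice `#θ u`.
sign-split : ∀ {a b c} → LetterSplit a b c → ∀ u v →
  sign (η a ℕ.* (#θ u ℕ.+ #θ v)) * sign (inversions (b ∷ u) (c ∷ v) ℕ.+ #θ (c ∷ v) ℕ.* #θ (b ∷ u)) ≡
  sign (inversions u v ℕ.+ #θ v ℕ.* #θ u) * sign (koszul b c (#θ u) (#θ v))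
sign-split {a} {b} {c} s u v = begin
  sign (η a ℕ.* (#θ u ℕ.+ #θ v)) * sign (inversions (b ∷ u) (c ∷ v) ℕ.+ #θ (c ∷ v) ℕ.* #θ (b ∷ u))
    ≡⟨ sign-+ (η a ℕ.* (#θ u ℕ.+ #θ v)) _ ⟨
  sign (η a ℕ.* (#θ u ℕ.+ #θ v) ℕ.+ (inversions (b ∷ u) (c ∷ v) ℕ.+ #θ (c ∷ v) ℕ.* #θ (b ∷ u)))
    ≡⟨ parity s ⟩
  sign (inversions u v ℕ.+ #θ v ℕ.* #θ u ℕ.+ koszul b c (#θ u) (#θ v))
    ≡⟨ sign-+ (inversions u v ℕ.+ #θ v ℕ.* #θ u) (koszul b c (#θ u) (#θ v)) ⟩
  sign (inversions u v ℕ.+ #θ v ℕ.* #θ u) * sign (koszul b c (#θ u) (#θ v))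
    ∎
  where
  oddˡ-exponent : ∀ U V I →
    1 ℕ.* (U ℕ.+ V) ℕ.+ (I ℕ.+ V ℕ.* suc U) ≡
    I ℕ.+ V ℕ.* U ℕ.+ (0 ℕ.* U ℕ.+ (1 ℕ.* U ℕ.+ 0 ℕ.* V)) ℕ.+ (V ℕ.+ V)
  oddˡ-exponent = solve-∀
  oddʳ-exponent : ∀ U V I →
    1 ℕ.* (U ℕ.+ V) ℕ.+ (U ℕ.+ I ℕ.+ suc V ℕ.* U) ≡
    I ℕ.+ V ℕ.* U ℕ.+ (1 ℕ.* U ℕ.+ (0 ℕ.* U ℕ.+ 1 ℕ.* V)) ℕ.+ (U ℕ.+ U)
  oddʳ-exponent = solve-∀
  parity : ∀ {a b c} → LetterSplit a b c →
    sign (η a ℕ.* (#θ u ℕ.+ #θ v) ℕ.+ (inversions (b ∷ u) (c ∷ v) ℕ.+ #θ (c ∷ v) ℕ.* #θ (b ∷ u))) ≡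
    sign (inversions u v ℕ.+ #θ v ℕ.* #θ u ℕ.+ koszul b c (#θ u) (#θ v))
  parity (even _) = cong sign (sym (ℕ.+-identityʳ (inversions u v ℕ.+ #θ v ℕ.* #θ u)))
  parity (oddˡ _) = sign-+-double {n = inversions u v ℕ.+ #θ v ℕ.* #θ u ℕ.+ (0 ℕ.* #θ u ℕ.+ (1 ℕ.* #θ u ℕ.+ 0 ℕ.* #θ v))} (#θ v) (oddˡ-exponent (#θ u) (#θ v) (inversions u v))
  parity (oddʳ _) = sign-+-double {n = inversions u v ℕ.+ #θ v ℕ.* #θ u ℕ.+ (1 ℕ.* #θ u ℕ.+ (0 ℕ.* #θ u ℕ.+ 1 ℕ.* #θ v))} (#θ u) (oddʳ-exponent (#θ u) (#θ v) (inversions u v))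

-- The two sides are the values of h at the coproduct of the evaluated word and at the evaluated
-- coproduct of the word. This is where compatibility of Δ with multiplication is proved, by
-- recursion on the word with h varying.
wordSign-splitSum : ∀ h w → wordSign w * splitSum h (leading (composition w)) ≡
  functional (λ (u , v) → wordSign u * wordSign v * h (composition u , composition v)) (ΔWord w)
wordSign-splitSum h [] = begin
  1ℚ * (1ℚ * h ([] , []) + 0ℚ)
    ≡⟨ cong (1ℚ *_) (ℚ.+-identityʳ (1ℚ * h ([] , []))) ⟩
  1ℚ * (1ℚ * h ([] , []))
    ≡⟨ ℚ.*-assoc 1ℚ 1ℚ (h ([] , [])) ⟨
  1ℚ * 1ℚ * h ([] , [])
    ≡⟨ basis⊗basis (λ (u , v) → wordSign u * wordSign v * h (composition u , composition v)) [] [] ⟨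
  functional (λ (u , v) → wordSign u * wordSign v * h (composition u , composition v)) Free.𝟙₂
    ∎
wordSign-splitSum h (g ∷ w) = begin
  wordSign (g ∷ w) * splitSum h (a ∷ W)
    ≡⟨ cong (wordSign (g ∷ w) *_) (∑-factorisations-∷ (λ (u , v) →
         sign (inversions u v ℕ.+ #θ v ℕ.* #θ u) * h (strip u , strip v)) a W) ⟩
  wordSign (g ∷ w) * ∑ℚ (letterFactorisations a) (λ (b , c) → ∑ℚ fs λ (u , v) → term b c u v)
    ≡⟨ *-∑ℚ (wordSign (g ∷ w)) (λ (b , c) → ∑ℚ fs λ (u , v) → term b c u v) (letterFactorisations a) ⟩
  ∑ℚ (letterFactorisations a) (λ (b , c) → wordSign (g ∷ w) * ∑ℚ fs λ (u , v) → term b c u v)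
    ≡⟨ ∑ℚ-cong-All (All.map (λ {(b , c)} s → regroup b c s) (letterFactorisations-split a)) ⟩
  ∑ℚ (letterFactorisations a) (λ (b , c) → wordSign w * splitSum (h′ b c) W)
    -- `h′ b c` prepends the two halves of the first letter and carries the `koszul` sign; `regroup`
    -- reaches it from the side of `sNSym` and `absorb` from the free side.
    ≡⟨ ∑ℚ-cong (letterFactorisations a) (λ (b , c) → wordSign-splitSum (h′ b c) w) ⟩
  ∑ℚ (letterFactorisations a) (λ (b , c) → functional (λ (u , v) →
    wordSign u * wordSign v * h′ b c (composition u , composition v)) (ΔWord w))
    ≡⟨ ∑ℚ-cong (letterFactorisations a) (λ (b , c) → functional-cong (ΔWord w) λ (u , v) → absorb b c u v) ⟨
  ∑ℚ (letterFactorisations a) (λ (b , c) → functional (λ (u , v) →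
    sign (fermWord (wordOfLetter c) ℕ.* fermWord u) * k (wordOfLetter b ++ u , wordOfLetter c ++ v)) (ΔWord w))
    ≡⟨ functional-ΔGenerator (λ (b , c) → functional (λ (u , v) →
         sign (fermWord c ℕ.* fermWord u) * k (b ++ u , c ++ v)) (ΔWord w)) g ⟨
  functional (λ (b , c) → functional (λ (u , v) →
    sign (fermWord c ℕ.* fermWord u) * k (b ++ u , c ++ v)) (ΔWord w)) (ΔGenerator g)
    ≡⟨ functional-·₂ k (ΔGenerator g) (ΔWord w) ⟨
  functional k (ΔWord (g ∷ w))
    ∎
  where
  a  = letter (part g)
  W  = leading (composition w)
  fs = factorisations W

  k : Word × Word → ℚ
  k (u , v) = wordSign u * wordSign v * h (composition u , composition v)

  h″ : Letter → Letter → DComp × DComp → ℚ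
  h″ b c (α , β) = h (strippedLetter b ++ α , strippedLetter c ++ β)

  h′ : Letter → Letter → DComp × DComp → ℚ
  h′ b c (α , β) = sign (koszul b c (ferm α) (ferm β)) * h″ b c (α , β)

  term : Letter → Letter → Mono → Mono → ℚ
  term b c u v = sign (inversions (b ∷ u) (c ∷ v) ℕ.+ #θ (c ∷ v) ℕ.* #θ (b ∷ u))
                 * h″ b c (strip u , strip v)

  η-part : ∀ g → fermWord (g ∷ []) ≡ η (letter (part g))
  η-part `H[1+ _ ] = refl
  η-part `H̃[ _ ]   = refl

  regroup : ∀ b c → LetterSplit a b c →
    wordSign (g ∷ w) * ∑ℚ fs (λ (u , v) → term b c u v) ≡ wordSign w * splitSum (h′ b c) W
  regroup b c s = begin
    e * wordSign w * ∑ℚ fs (λ (u , v) → term b c u v)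
      ≡⟨ cong (_* ∑ℚ fs (λ (u , v) → term b c u v)) (ℚ.*-comm e (wordSign w)) ⟩
    wordSign w * e * ∑ℚ fs (λ (u , v) → term b c u v)
      ≡⟨ ℚ.*-assoc (wordSign w) e (∑ℚ fs (λ (u , v) → term b c u v)) ⟩
    wordSign w * (e * ∑ℚ fs (λ (u , v) → term b c u v))
      ≡⟨ cong (wordSign w *_) (*-∑ℚ e (λ (u , v) → term b c u v) fs) ⟩
    wordSign w * ∑ℚ fs (λ (u , v) → e * term b c u v)
      ≡⟨ cong (wordSign w *_) (∑ℚ-cong-All (All.map (λ {(u , v)} → pointwise u v) (factorisations-split W))) ⟩
    wordSign w * splitSum (h′ b c) W
      ∎
    where
    e = sign (fermWord (g ∷ []) ℕ.* fermWord w)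
    pointwise : ∀ u v → Split W u v → e * term b c u v ≡
      sign (inversions u v ℕ.+ #θ v ℕ.* #θ u) * h′ b c (strip u , strip v)
    pointwise u v t = begin
      e * (τ * x)
        ≡⟨ ℚ.*-assoc e τ x ⟨
      e * τ * x
        -- The sign from `wordSign` sees only the whole word; its dotted count is distributed over
        -- the two factors so that it can be compared within one factorisation.
        ≡⟨ cong₂ (λ m n → sign (m ℕ.* n) * τ * x) (η-part g) (trans (sym (#θ-leading w)) (#θ-split t)) ⟩
      sign (η a ℕ.* (#θ u ℕ.+ #θ v)) * τ * x
        ≡⟨ cong (_* x) (sign-split s u v) ⟩
      σ * sign (koszul b c (#θ u) (#θ v)) * x
        ≡⟨ ℚ.*-assoc σ _ x ⟩
      σ * (sign (koszul b c (#θ u) (#θ v)) * x)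
        ≡⟨ cong₂ (λ m n → σ * (sign (koszul b c m n) * x)) (ferm-strip u) (ferm-strip v) ⟨
      σ * h′ b c (strip u , strip v)
        ∎
      where
      σ = sign (inversions u v ℕ.+ #θ v ℕ.* #θ u)
      τ = sign (inversions (b ∷ u) (c ∷ v) ℕ.+ #θ (c ∷ v) ℕ.* #θ (b ∷ u))
      x = h″ b c (strip u , strip v)

  absorb : ∀ b c u v →
    sign (fermWord (wordOfLetter c) ℕ.* fermWord u) * k (wordOfLetter b ++ u , wordOfLetter c ++ v) ≡
    wordSign u * wordSign v * h′ b c (composition u , composition v)
  absorb b c u v
    rewrite fermWord-wordOfLetter c
          | sym (ferm-composition u)
          | wordSign-wordOfLetter-++ b u
          | wordSign-wordOfLetter-++ c v
          | composition-wordOfLetter-++ b u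
          | composition-wordOfLetter-++ c v
          | sign-+ (η c ℕ.* ferm (composition u)) (η b ℕ.* ferm (composition u) ℕ.+ η c ℕ.* ferm (composition v))
          | sign-+ (η b ℕ.* ferm (composition u)) (η c ℕ.* ferm (composition v))
    = rearrange (sign (η c ℕ.* ferm (composition u))) (wordSign u) (sign (η b ℕ.* ferm (composition u)))
        (wordSign v) (sign (η c ℕ.* ferm (composition v))) (h″ b c (composition u , composition v))
    where
    rearrange : ∀ p x q y r z → p * ((x * q) * (y * r) * z) ≡ x * y * (p * (q * r) * z)
    rearrange = solve 6 (λ p x q y r z →
      p :* ((x :* q) :* (y :* r) :* z) := x :* y :* (p :* (q :* r) :* z)) refl

-- The isomorphism

open Equality (List.≡-dec _≟ᴳ_) using () renaming (coeff to coeffᵂ)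
open Equality _≟ᴰ_ using () renaming (coeff to coeffᴰ)

_≟ᵂ_ : DecidableEquality Word
_≟ᵂ_ = List.≡-dec _≟ᴳ_

δ-composition : ∀ w α → δ _≟ᴰ_ (composition w) α ≡ δ _≟ᵂ_ (word α) w
δ-composition w α = δ-⇔ _≟ᴰ_ _≟ᵂ_ {composition w} {α} {word α} {w} (mk⇔
  (λ { refl → word-composition w }) (λ { refl → composition-word α }))

δ-sym : (_≟_ : DecidableEquality B) (b b′ : B) → δ _≟_ b b′ ≡ δ _≟_ b′ b
δ-sym _≟_ b b′ = δ-⇔ _≟_ _≟_ {b} {b′} {b′} {b} (mk⇔ sym sym)

-- Words and compositions correspond bijectively, and `evaluate` matches the two bases up to sign,
-- so a coefficient of the image comes from one word only.
coeff-evaluate : ∀ f α → coeffᴰ (evaluate f) α ≡ wordSign (word α) * coeffᵂ f (word α)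
coeff-evaluate f α = begin
  coeffᴰ (evaluate f) α
    ≡⟨ functional-evaluate (λ β → δ _≟ᴰ_ β α) f ⟩
  functional (λ w → wordSign w * δ _≟ᴰ_ (composition w) α) f
    ≡⟨ functional-cong f (λ w → begin
         wordSign w * δ _≟ᴰ_ (composition w) α
           ≡⟨ cong (wordSign w *_) (δ-composition w α) ⟩
         wordSign w * δ _≟ᵂ_ (word α) w
           ≡⟨ ℚ.*-comm (wordSign w) _ ⟩
         δ _≟ᵂ_ (word α) w * wordSign w
           ≡⟨ δ-*-subst _≟ᵂ_ wordSign (word α) w ⟩
         δ _≟ᵂ_ (word α) w * wordSign (word α)
           ≡⟨ ℚ.*-comm (δ _≟ᵂ_ (word α) w) (wordSign (word α)) ⟩
         wordSign (word α) * δ _≟ᵂ_ (word α) w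
           ≡⟨ cong (wordSign (word α) *_) (δ-sym _≟ᵂ_ (word α) w) ⟩
         wordSign (word α) * δ _≟ᵂ_ w (word α)
           ∎) ⟩
  functional (λ w → wordSign (word α) * δ _≟ᵂ_ w (word α)) f
    ≡⟨ functional-* (wordSign (word α)) (λ w → δ _≟ᵂ_ w (word α)) f ⟩
  wordSign (word α) * coeffᵂ f (word α)
    ∎

coeff-word : ∀ f w → coeffᵂ f w ≡ wordSign w * coeffᴰ (evaluate f) (composition w)
coeff-word f w = begin
  coeffᵂ f w
    ≡⟨ ℚ.*-identityˡ (coeffᵂ f w) ⟨
  1ℚ * coeffᵂ f w
    ≡⟨ cong (_* coeffᵂ f w) (wordSign² w) ⟨
  wordSign w * wordSign w * coeffᵂ f w
    ≡⟨ ℚ.*-assoc (wordSign w) (wordSign w) (coeffᵂ f w) ⟩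
  wordSign w * (wordSign w * coeffᵂ f w)
    ≡⟨ cong (λ v → wordSign w * (wordSign v * coeffᵂ f v)) (word-composition w) ⟨
  wordSign w * (wordSign (word (composition w)) * coeffᵂ f (word (composition w)))
    ≡⟨ cong (wordSign w *_) (coeff-evaluate f (composition w)) ⟨
  wordSign w * coeffᴰ (evaluate f) (composition w)
    ∎

-- Equal elements may be different lists with cancelling terms; what makes `evaluate` respect
-- equality is that the image's coefficients are computed from those of f.
evaluate-cong : ∀ {f g} → f Free.≈ g → evaluate f SNSym.≈ evaluate g
evaluate-cong {f} {g} e α = begin
  coeffᴰ (evaluate f) α                    ≡⟨ coeff-evaluate f α ⟩
  wordSign (word α) * coeffᵂ f (word α)    ≡⟨ cong (wordSign (word α) *_) (e (word α)) ⟩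
  wordSign (word α) * coeffᵂ g (word α)    ≡⟨ coeff-evaluate g α ⟨
  coeffᴰ (evaluate g) α                    ∎

evaluate-injective : ∀ {f g} → evaluate f SNSym.≈ evaluate g → f Free.≈ g
evaluate-injective {f} {g} e w = begin
  coeffᵂ f w                                          ≡⟨ coeff-word f w ⟩
  wordSign w * coeffᴰ (evaluate f) (composition w)    ≡⟨ cong (wordSign w *_) (e (composition w)) ⟩
  wordSign w * coeffᴰ (evaluate g) (composition w)    ≡⟨ coeff-word g w ⟨
  coeffᵂ g w                                          ∎

-- A sign is its own inverse, so the same `wordSign` corrects each basis element.
evaluate⁻¹ : sNSym → FreeAlgebra
evaluate⁻¹ = linear λ α → wordSign (word α) • basis (word α)

functional-evaluate-evaluate⁻¹ : ∀ h F → functional h (evaluate (evaluate⁻¹ F)) ≡ functional h F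
functional-evaluate-evaluate⁻¹ h F = begin
  functional h (evaluate (evaluate⁻¹ F))
    ≡⟨ functional-evaluate h (evaluate⁻¹ F) ⟩
  functional k (evaluate⁻¹ F)
    ≡⟨ functional-linear k (λ α → wordSign (word α) • basis (word α)) F ⟩
  functional (λ α → functional k (wordSign (word α) • basis (word α))) F
    ≡⟨ functional-cong F (λ α → begin
         functional k (wordSign (word α) • basis (word α))
           ≡⟨ functional-• k (wordSign (word α)) (basis (word α)) ⟩
         wordSign (word α) * functional k (basis (word α))
           ≡⟨ cong (wordSign (word α) *_) (functional-basis k (word α)) ⟩
         wordSign (word α) * (wordSign (word α) * h (composition (word α)))
           ≡⟨ ℚ.*-assoc (wordSign (word α)) (wordSign (word α)) _ ⟨
         wordSign (word α) * wordSign (word α) * h (composition (word α))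
           ≡⟨ cong₂ _*_ (wordSign² (word α)) (cong h (composition-word α)) ⟩
         1ℚ * h α
           ≡⟨ ℚ.*-identityˡ (h α) ⟩
         h α
           ∎) ⟩
  functional h F
    ∎
  where
  k : Word → ℚ
  k w = wordSign w * h (composition w)

functional-evaluate-⊞ : ∀ h f g →
  functional h (evaluate (f ⊞ g)) ≡ functional h (evaluate f ⊞ evaluate g)
functional-evaluate-⊞ h f g = begin
  functional h (evaluate (f ⊞ g))
    ≡⟨ functional-linear h evaluateWord (f ⊞ g) ⟩
  functional k (f ⊞ g)
    ≡⟨ functional-++ k f g ⟩
  functional k f + functional k g
    ≡⟨ cong₂ _+_ (functional-linear h evaluateWord f) (functional-linear h evaluateWord g) ⟨
  functional h (evaluate f) + functional h (evaluate g)
    ≡⟨ functional-++ h (evaluate f) (evaluate g) ⟨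
  functional h (evaluate f ⊞ evaluate g)
    ∎
  where
  k : Word → ℚ
  k w = functional h (evaluateWord w)

functional-evaluate-• : ∀ h c f → functional h (evaluate (c • f)) ≡ functional h (c • evaluate f)
functional-evaluate-• h c f = begin
  functional h (evaluate (c • f))     ≡⟨ functional-linear h evaluateWord (c • f) ⟩
  functional k (c • f)                ≡⟨ functional-• k c f ⟩
  c * functional k f                  ≡⟨ cong (c *_) (functional-linear h evaluateWord f) ⟨
  c * functional h (evaluate f)       ≡⟨ functional-• h c (evaluate f) ⟨
  functional h (c • evaluate f)       ∎
  where
  k : Word → ℚ
  k w = functional h (evaluateWord w)

functional-evaluate-· : ∀ h f g →
  functional h (evaluate (f Free.· g)) ≡ functional h (evaluate f SNSym.· evaluate g)
functional-evaluate-· h f g = begin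
  functional h (evaluate (f Free.· g))
    ≡⟨ functional-evaluate h (f Free.· g) ⟩
  functional k (f Free.· g)
    ≡⟨ functional-bilinear k (λ u v → basis (u ++ v)) f g ⟩
  functional (λ u → functional (λ v → functional k (basis (u ++ v))) g) f
    ≡⟨ functional-cong f (λ u → begin
         functional (λ v → functional k (basis (u ++ v))) g
           ≡⟨ functional-cong g (λ v → trans (functional-basis k (u ++ v)) (split u v)) ⟩
         functional (λ v → wordSign u * (wordSign v * l (composition u) (composition v))) g
           ≡⟨ functional-* (wordSign u) (λ v → wordSign v * l (composition u) (composition v)) g ⟩
         wordSign u * functional (λ v → wordSign v * l (composition u) (composition v)) g
           ≡⟨ cong (wordSign u *_) (functional-evaluate (l (composition u)) g) ⟨
         wordSign u * functional (l (composition u)) (evaluate g)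
           ∎) ⟩
  functional (λ u → wordSign u * functional (l (composition u)) (evaluate g)) f
    ≡⟨ functional-evaluate (λ α → functional (l α) (evaluate g)) f ⟨
  functional (λ α → functional (l α) (evaluate g)) (evaluate f)
    -- `l α β` is the value of h at H_α H_β, so the double sum is the product in `sNSym`.
    ≡⟨ functional-cong (evaluate f) (λ α → functional-cong (evaluate g) (functional-H-product h α)) ⟨
  functional (λ α → functional (λ β → functional h (H-product α β)) (evaluate g)) (evaluate f)
    ≡⟨ functional-bilinear h H-product (evaluate f) (evaluate g) ⟨
  functional h (evaluate f SNSym.· evaluate g)
    ∎
  where
  k : Word → ℚ
  k w = wordSign w * h (composition w)

  l : DComp → DComp → ℚ
  l α β = sign (ferm α ℕ.* ferm β) * h (α ++ β)

  rearrange : ∀ a b c d → a * b * c * d ≡ a * (b * (c * d))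
  rearrange = solve 4 (λ a b c d → a :* b :* c :* d := a :* (b :* (c :* d))) refl

  split : ∀ u v → k (u ++ v) ≡ wordSign u * (wordSign v * l (composition u) (composition v))
  split u v = begin
    wordSign (u ++ v) * h (composition (u ++ v))
      ≡⟨ cong₂ _*_ (wordSign-++ u v) (cong h (List.map-++ part u v)) ⟩
    wordSign u * wordSign v * sign (fermWord u ℕ.* fermWord v) * h (composition u ++ composition v)
      ≡⟨ cong₂ (λ m n → wordSign u * wordSign v * sign (m ℕ.* n) * h (composition u ++ composition v))
           (ferm-composition u) (ferm-composition v) ⟨
    wordSign u * wordSign v * sign (ferm (composition u) ℕ.* ferm (composition v))
      * h (composition u ++ composition v)
      ≡⟨ rearrange (wordSign u) (wordSign v) (sign (ferm (composition u) ℕ.* ferm (composition v)))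
           (h (composition u ++ composition v)) ⟩
    wordSign u * (wordSign v * l (composition u) (composition v))
      ∎

evaluate-isRingIsomorphism : IsRingIsomorphism Free.rawRing SNSym.rawRing evaluate
evaluate-isRingIsomorphism = record
  { isRingMonomorphism = record
    { isRingHomomorphism = record
      { isSemiringHomomorphism = record
        { isNearSemiringHomomorphism = record
          { +-isMonoidHomomorphism = record
            { isMagmaHomomorphism = record
              { isRelHomomorphism = record { cong = λ {f} {g} → evaluate-cong {f} {g} }
              ; homo = λ f g α → functional-evaluate-⊞ (λ β → δ _≟ᴰ_ β α) f g
              }
            ; ε-homo = λ _ → refl
            }
          ; *-homo = λ f g α → functional-evaluate-· (λ β → δ _≟ᴰ_ β α) f g
          }
        ; 1#-homo = λ α → functional-evaluate-𝟙 (λ β → δ _≟ᴰ_ β α)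
        }
      ; -‿homo = λ f α → functional-evaluate-• (λ β → δ _≟ᴰ_ β α) (- 1ℚ) f
      }
    ; injective = λ {f} {g} → evaluate-injective {f} {g}
    }
  -- Surjectivity up to equality asks for the image of every f equal to the chosen preimage, so
  -- congruence is applied first.
  ; surjective = λ F → evaluate⁻¹ F , λ {f} e α → trans
      (evaluate-cong {f} {evaluate⁻¹ F} e α)
      (functional-evaluate-evaluate⁻¹ (λ β → δ _≟ᴰ_ β α) F)
  }
  where
  functional-evaluate-𝟙 : ∀ h → functional h (evaluate Free.𝟙) ≡ functional h SNSym.𝟙
  functional-evaluate-𝟙 h = trans (functional-linear h evaluateWord Free.𝟙)
    (functional-basis (λ w → functional h (evaluateWord w)) [])

-- The coproduct formulas

functional-ΔS : ∀ h F → functional h (ΔS F) ≡ functional (λ γ → splitSum h (leading γ)) F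
functional-ΔS h F =
  trans (functional-linear h H-coproduct F) (functional-cong F (functional-H-coproduct h))

functional-ΔS-Hᴰ : ∀ h γ → functional h (ΔS (Hᴰ γ)) ≡ splitSum h (leading γ)
functional-ΔS-Hᴰ h γ = trans (functional-ΔS h (Hᴰ γ)) (functional-basis (λ γ → splitSum h (leading γ)) γ)

functional-ΔS-evaluate : ∀ h f →
  functional h (ΔS (evaluate f)) ≡ functional h (evaluate⊗evaluate (ΔFree f))
functional-ΔS-evaluate h f = begin
  functional h (ΔS (evaluate f))
    ≡⟨ functional-ΔS h (evaluate f) ⟩
  functional (λ γ → splitSum h (leading γ)) (evaluate f)
    ≡⟨ functional-evaluate (λ γ → splitSum h (leading γ)) f ⟩
  functional (λ w → wordSign w * splitSum h (leading (composition w))) f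
    ≡⟨ functional-cong f (wordSign-splitSum h) ⟩
  functional (λ w → functional (λ (u , v) →
    wordSign u * wordSign v * h (composition u , composition v)) (ΔWord w)) f
    ≡⟨ functional-cong f (λ w → functional-cong (ΔWord w) λ (u , v) → functional-evaluateWord-⊗ h u v) ⟨
  functional (λ w → functional (λ (u , v) → functional h (evaluateWord u ⊗ evaluateWord v)) (ΔWord w)) f
    ≡⟨ functional-linear (λ (u , v) → functional h (evaluateWord u ⊗ evaluateWord v)) ΔWord f ⟨
  functional (λ (u , v) → functional h (evaluateWord u ⊗ evaluateWord v)) (ΔFree f)
    ≡⟨ functional-linear h (λ (u , v) → evaluateWord u ⊗ evaluateWord v) (ΔFree f) ⟨
  functional h (evaluate⊗evaluate (ΔFree f))
    ∎

-- With a single letter at most one factor carries a θ: there is nothing to invert or to exchange,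
-- and all signs are 1. Hence the generator formulas are free of signs.
splitSum-letter : ∀ h a → splitSum h (a ∷ []) ≡
  ∑ℚ (letterFactorisations a) (λ (b , c) → h (strippedLetter b , strippedLetter c))
splitSum-letter h a = trans
  (∑-factorisations-∷ (λ (u , v) → sign (inversions u v ℕ.+ #θ v ℕ.* #θ u) * h (strip u , strip v)) a [])
  (∑ℚ-cong-All (All.map (λ {(b , c)} → term b c) (letterFactorisations-split a)))
  where
  sign-0 : ∀ {b c} → LetterSplit a b c → sign (inversions (b ∷ []) (c ∷ []) ℕ.+ η c ℕ.* η b) ≡ 1ℚ
  sign-0 (even _) = refl
  sign-0 (oddˡ _) = refl
  sign-0 (oddʳ _) = refl
  term : ∀ b c → LetterSplit a b c →
    sign (inversions (b ∷ []) (c ∷ []) ℕ.+ η c ℕ.* η b) * h (strip (b ∷ []) , strip (c ∷ [])) + 0ℚ ≡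
    h (strippedLetter b , strippedLetter c)
  term b c s
    rewrite sign-0 s | List.++-identityʳ (strippedLetter b) | List.++-identityʳ (strippedLetter c)
    = trans (ℚ.+-identityʳ (1ℚ * h (strippedLetter b , strippedLetter c)))
            (ℚ.*-identityˡ (h (strippedLetter b , strippedLetter c)))

H-basis : ∀ i → H i ≡ Hᴰ (strippedLetter (false , i))
H-basis zero    = refl
H-basis (suc _) = refl

functional-H⊗H : ∀ h i j → functional h (H i ⊗ H j) ≡
                 h (strippedLetter (false , i) , strippedLetter (false , j))
functional-H⊗H h i j = trans
  (cong₂ (λ x y → functional h (x ⊗ y)) (H-basis i) (H-basis j))
  (basis⊗basis h (strippedLetter (false , i)) (strippedLetter (false , j)))

functional-ΔS-H : ∀ h n →
  functional h (ΔS (H n)) ≡ functional h (∑ (antidiagonal n) λ (i , j) → H i ⊗ H j)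
functional-ΔS-H h n = begin
  functional h (ΔS (H n))
    ≡⟨ by n ⟩
  ∑ℚ (antidiagonal n) (λ (i , j) → h (strippedLetter (false , i) , strippedLetter (false , j)))
    ≡⟨ ∑ℚ-cong (antidiagonal n) (λ (i , j) → functional-H⊗H h i j) ⟨
  ∑ℚ (antidiagonal n) (λ (i , j) → functional h (H i ⊗ H j))
    ≡⟨ functional-∑ h (antidiagonal n) (λ (i , j) → H i ⊗ H j) ⟨
  functional h (∑ (antidiagonal n) λ (i , j) → H i ⊗ H j)
    ∎
  where
  by : ∀ n → functional h (ΔS (H n)) ≡
    ∑ℚ (antidiagonal n) (λ (i , j) → h (strippedLetter (false , i) , strippedLetter (false , j)))
  -- Here `H 0` is the unit, indexed by the empty composition, and the empty monomial has one
  -- factorisation.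
  by zero    = trans (functional-ΔS-Hᴰ h []) (cong (_+ 0ℚ) (ℚ.*-identityˡ (h ([] , []))))
  by (suc m) = trans (functional-ΔS-Hᴰ h (plain[1+ m ] ∷ [])) (trans
    (splitSum-letter h (false , suc m))
    (∑-letterFactorisations-plain (λ (b , c) → h (strippedLetter b , strippedLetter c)) (suc m)))

functional-ΔS-H̃ : ∀ h n → functional h (ΔS (H̃ n)) ≡
  functional h (∑ (antidiagonal n) λ (k , l) → H̃ k ⊗ H l ⊞ H l ⊗ H̃ k)
functional-ΔS-H̃ h n = begin
  functional h (ΔS (H̃ n))
    ≡⟨ functional-ΔS-Hᴰ h (dotted[ n ] ∷ []) ⟩
  splitSum h ((true , n) ∷ [])
    ≡⟨ splitSum-letter h (true , n) ⟩
  ∑ℚ (letterFactorisations (true , n)) (λ (b , c) → h (strippedLetter b , strippedLetter c))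
    ≡⟨ ∑-letterFactorisations-dotted (λ (b , c) → h (strippedLetter b , strippedLetter c)) n ⟩
  ∑ℚ (antidiagonal n) (λ (k , l) → h (strippedLetter (true , k) , strippedLetter (false , l))
                                 + h (strippedLetter (false , l) , strippedLetter (true , k)))
    ≡⟨ ∑ℚ-cong (antidiagonal n) (λ (k , l) → trans
         (functional-++ h (H̃ k ⊗ H l) (H l ⊗ H̃ k))
         (trans (cong (λ x → functional h (H̃ k ⊗ x) + functional h (x ⊗ H̃ k)) (H-basis l))
           (cong₂ _+_ (basis⊗basis h (strippedLetter (true , k)) (strippedLetter (false , l)))
                      (basis⊗basis h (strippedLetter (false , l)) (strippedLetter (true , k)))))) ⟨
  ∑ℚ (antidiagonal n) (λ (k , l) → functional h (H̃ k ⊗ H l ⊞ H l ⊗ H̃ k))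
    ≡⟨ functional-∑ h (antidiagonal n) (λ (k , l) → H̃ k ⊗ H l ⊞ H l ⊗ H̃ k) ⟨
  functional h (∑ (antidiagonal n) λ (k , l) → H̃ k ⊗ H l ⊞ H l ⊗ H̃ k)
    ∎

proposition6p2 : IsRingIsomorphism Free.rawRing SNSym.rawRing evaluate
    × (∀ (c : ℚ) (f : FreeAlgebra) → evaluate (c • f) SNSym.≈ c • evaluate f)
    × (∀ (f : FreeAlgebra) → ΔS (evaluate f) SNSym.≈₂ evaluate⊗evaluate (ΔFree f))
    × (∀ (n : ℕ) → ΔS (H n) SNSym.≈₂ ∑ (antidiagonal n) (λ (i , j) → H i ⊗ H j))
    × (∀ (i : ℕ) → ΔS (H̃ i) SNSym.≈₂
    ∑ (antidiagonal i) (λ (k , l) → H̃ k ⊗ H l ⊞ H l ⊗ H̃ k))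
proposition6p2 =
    evaluate-isRingIsomorphism
  , (λ c f α → functional-evaluate-• (λ β → δ _≟ᴰ_ β α) c f)
  , (λ f p → functional-ΔS-evaluate (δ₂ p) f)
  , (λ n p → functional-ΔS-H (δ₂ p) n)
  , (λ i p → functional-ΔS-H̃ (δ₂ p) i)
  where
  -- Equality in the tensor square is tested by these coordinate functionals, at which the
  -- identities for arbitrary h are specialised.
  δ₂ : DComp × DComp → DComp × DComp → ℚ
  δ₂ p q = δ (Product.≡-dec _≟ᴰ_ _≟ᴰ_) q p
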